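{- Let $r \ge 1$, $a \ge 2$, $t \ge 1$ and $s \ge 0$ be integers. Then $\sigma(r,s,a,t) \le r \left\lceil \frac{tr+s+1}{a}\right\rceil + (t-1)r + 1$.
   Context: All graphs are finite simple graphs. A $(d,d+s)$-graph is a graph all of whose vertex degrees lie in $\{d, \ldots, d+s\}$. An $(r,r+a)$-factor of $G$ is a spanning subgraph all of whose degrees lie in $\{r,\ldots,r+a\}$; an $(r,r+a)$-factorization of $G$ with $x$ factors is a decomposition of $E(G)$ into $x$ edge-disjoint $(r,r+a)$-factors. $\sigma(r,s,a,t)$ is the least integer such that, whenever $d \ge \sigma(r,s,a,t)$, every simple $(d,d+s)$-graph has an $(r,r+a)$-factorization with $x$ factors for at least $t$ different values of $x$. -}

module Defs where

open import Data.Nat using (ℕ; zero; suc; _+_; _*_; _∸_; _≤_; _/_)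
open import Data.Bool using (Bool; true; false; _∧_; not)
open import Data.Fin using (Fin; _≟_)
open import Data.List using (List; length; filterᵇ; allFin)
open import Data.Product using (Σ; _×_)
open import Relation.Binary.PropositionalEquality using (_≡_)
open import Relation.Nullary.Decidable using (⌊_⌋)
open import Function.Definitions using (Injective)

record Graph (n : ℕ) : Set where
  field
    adj    : Fin n → Fin n → Bool
    sym    : ∀ u v → adj u v ≡ adj v u
    irrefl : ∀ v → adj v v ≡ false
open Graph public

deg : ∀ {n} → Graph n → Fin n → ℕ
deg {n} G v = length (filterᵇ (λ u → adj G v u) (allFin n))

IsDDSGraph : ∀ {n} → ℕ → ℕ → Graph n → Set
IsDDSGraph {n} d s G = ∀ (v : Fin n) → d ≤ deg G v × deg G v ≤ d + s

-- A decomposition of E(G) into x edge-disjoint spanning subgraphs, encoded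
-- as an assignment of a factor index in Fin x to every edge (symmetric).
-- facDeg G c k v = degree of v in the k-th factor.
facDeg : ∀ {n x} → Graph n → (Fin n → Fin n → Fin x) → Fin x → Fin n → ℕ
facDeg {n} G c k v =
  length (filterᵇ (λ u → adj G v u ∧ ⌊ c v u ≟ k ⌋) (allFin n))

record Factorization {n : ℕ} (G : Graph n) (r a x : ℕ) : Set where
  field
    colour    : Fin n → Fin n → Fin x
    colourSym : ∀ u v → colour u v ≡ colour v u
    factorDeg : ∀ (k : Fin x) (v : Fin n) →
                r ≤ facDeg G colour k v × facDeg G colour k v ≤ r + a

HasFactorizationsForTValues : ∀ {n} → Graph n → ℕ → ℕ → ℕ → Set
HasFactorizationsForTValues G r a t =
  Σ (Fin t → ℕ) λ f → Injective _≡_ _≡_ f × (∀ i → Factorization G r a (f i))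

ceilDiv : ℕ → ℕ → ℕ
ceilDiv m zero    = 0
ceilDiv m (suc b) = (m + b) / suc b

{-# OPTIONS --safe #-}
-- The values x = X, X − 1, …, X − t + 1 with X = ⌊(d − 1) / r⌋ all satisfy r x < deg w < (r + a) x
-- at every vertex w, and any such x works.  After adding a pendant edge at every vertex whose degree
-- is divisible by x it suffices to colour the edges with x colours such that at each vertex the
-- colour class sizes differ by at most one.
--
-- Such a balanced colouring is built vertex by vertex.  Let S be the set of balanced vertices and let
-- v be the next one.  Let N l be the number of edges of colour l at v.  If N i ≥ N j + 2, one shifts
-- edges at v along a sequence of colours (a Vizing fan): an edge vu of colour f may be given the colour
-- g whenever f and g have different frequencies at u, and as x does not divide deg u, some g always
-- qualifies.  Either the fan reaches a colour of frequency at most N j at v, or it closes up at a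
-- colour k.  In the latter case exchanging k and j on suitable alternating trails lets the fan continue
-- to j.  All this decreases Σ N l ², or else decreases the number of edges at v whose colour has minimal
-- frequency at their other end in S.
module Submission where

open import Defs renaming (sym to adj-sym)
import Data.Nat.Properties as ℕ
open import Algebra.Properties.CommutativeMonoid.Sum ℕ.+-0-commutativeMonoid
  using (sum; sum-cong-≗; ∑-distrib-+; ∑-comm)
open import Data.Bool using (Bool; true; false; _∧_)
import Data.Bool.Properties as Bool
open import Data.Empty using (⊥)
open import Data.Fin using (Fin; zero; suc; toℕ; _≟_)
open import Data.Fin.Permutation.Components using (transpose)
open import Data.Fin.Properties using (any?; all?; ¬∀⟶∃¬; toℕ<n; toℕ-injective)
open import Data.List using (List; []; _∷_; map; length; filterᵇ; tabulate; allFin)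
open import Data.List.Membership.Propositional using (_∈_; _∉_; find; lose)
open import Data.List.Membership.Propositional.Properties using (∈-map⁺; ∈-map⁻; ∈-allFin)
open import Data.List.Relation.Unary.Any as Any using (Any; here; there)
open import Data.Nat using
  (ℕ; zero; suc; _+_; _*_; _∸_; _/_; _%_; _≤_; _<_; _≤?_; z≤n; s≤s; s≤s⁻¹)
open import Data.Nat.Divisibility using (_∣_; _∣?_; divides; ∣m+n∣m⇒∣n; ∣1⇒≡1)
open import Data.Nat.DivMod using (m≡m%n+[m/n]*n; m%n<n; m/n*n≤m; m*n/n≡m; /-monoˡ-≤)
open import Data.Nat.Induction using (<-wellFounded)
open import Data.Nat.Properties hiding (_≟_)
open import Data.Nat.Solver using (module +-*-Solver)
open import Data.Product using (Σ; ∃; ∃₂; _×_; _,_; proj₁; proj₂; swap)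
open import Data.Product.Properties using (≡-dec)
open import Data.Sum using (_⊎_; inj₁; inj₂; map₂)
open import Data.Unit using (⊤; tt)
open import Data.Vec.Functional using (updateAt)
open import Data.Vec.Functional.Properties using (updateAt-updates; updateAt-minimal)
open import Function using (_∘_; id; const)
open import Induction.WellFounded using (Acc; acc)
open import Relation.Binary.Definitions using (DecidableEquality; tri<; tri≈; tri>)
open import Relation.Binary.PropositionalEquality
open import Relation.Nullary using (¬_; Dec; yes; no; does; contradiction; ¬?; _×-dec_; _⊎-dec_)
open import Relation.Nullary.Decidable using (isYes≗does)
open import Relation.Unary using (Decidable; _⊆_)
open +-*-Solver using (solve; _:+_; _:*_; _:=_; con)

-- Finite sums and sums of squares.

sum-mono : ∀ {n} {f g : Fin n → ℕ} → (∀ i → f i ≤ g i) → sum f ≤ sum g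
sum-mono {zero} f≤g = z≤n
sum-mono {suc n} f≤g = +-mono-≤ (f≤g zero) (sum-mono (f≤g ∘ suc))

sum-mono-< : ∀ {n} {f g : Fin n → ℕ} → (∀ i → f i ≤ g i) →
             ∀ a → f a < g a → sum f < sum g
sum-mono-< {suc n} f≤g zero lt = +-mono-<-≤ lt (sum-mono (f≤g ∘ suc))
sum-mono-< {suc n} f≤g (suc a) lt = +-mono-≤-< (f≤g zero) (sum-mono-< (f≤g ∘ suc) a lt)

sum-const : ∀ n m → sum {n} (λ _ → m) ≡ n * m
sum-const zero m = refl
sum-const (suc n) m = cong (m +_) (sum-const n m)

sum-replace : ∀ {n} {f g : Fin n → ℕ} a → (∀ i → i ≢ a → f i ≡ g i) →
              sum f + g a ≡ sum g + f a
sum-replace {suc n} {f} {g} zero same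
  rewrite sum-cong-≗ {n} {f ∘ suc} {g ∘ suc} (λ i → same (suc i) λ ()) =
  solve 3 (λ x y z → x :+ z :+ y := y :+ z :+ x) refl (f zero) (g zero) (sum (g ∘ suc))
sum-replace {suc n} {f} {g} (suc a) same
  rewrite same zero (λ ()) =
  trans (+-assoc (g zero) _ _)
    (trans (cong (g zero +_) (sum-replace a (λ i i≢a → same (suc i) λ { refl → i≢a refl })))
      (sym (+-assoc (g zero) _ _)))

sum-replace₂ : ∀ {n} {f g : Fin n → ℕ} {a b} → a ≢ b →
               (∀ i → i ≢ a → i ≢ b → f i ≡ g i) →
               sum f + (g a + g b) ≡ sum g + (f a + f b)
sum-replace₂ {n} {f} {g} {a} {b} a≢b same = begin
  sum f + (g a + g b)  ≡⟨ cong (λ z → sum f + (z + g b)) (sym ha) ⟩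
  sum f + (h a + g b)  ≡⟨ sym (+-assoc (sum f) (h a) (g b)) ⟩
  sum f + h a + g b    ≡⟨ cong (_+ g b) (sum-replace a f≗h) ⟩
  sum h + f a + g b    ≡⟨ solve 3 (λ x y z → x :+ y :+ z := x :+ z :+ y) refl (sum h) (f a) (g b) ⟩
  sum h + g b + f a    ≡⟨ cong (_+ f a) (sum-replace b h≗g) ⟩
  sum g + h b + f a    ≡⟨ cong (λ z → sum g + z + f a) (sym (f≗h b (a≢b ∘ sym))) ⟩
  sum g + f b + f a    ≡⟨ solve 3 (λ x y z → x :+ z :+ y := x :+ (y :+ z)) refl (sum g) (f a) (f b) ⟩
  sum g + (f a + f b)  ∎
  where
  open ≡-Reasoning
  h : Fin n → ℕ
  h i with i ≟ a
  ... | yes _ = g a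
  ... | no _ = f i
  ha : h a ≡ g a
  ha with a ≟ a
  ... | yes _ = refl
  ... | no ¬p = contradiction refl ¬p
  f≗h : ∀ i → i ≢ a → f i ≡ h i
  f≗h i i≢a with i ≟ a
  ... | yes p = contradiction p i≢a
  ... | no _ = refl
  h≗g : ∀ i → i ≢ b → h i ≡ g i
  h≗g i i≢b with i ≟ a
  ... | yes refl = refl
  ... | no i≢a = same i i≢a i≢b

-- With a + b = a′ + b′ and b ≤ a′, b′ ≤ a, write a′ = b + δ and b′ = b + ε.
squares-balance : ∀ {a b a′ b′} → a′ + b′ ≡ a + b → b ≤ a′ → b ≤ b′ →
  ∃₂ λ δ ε → a′ ≡ b + δ × b′ ≡ b + ε × a′ * a′ + b′ * b′ + 2 * (δ * ε) ≡ a * a + b * b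
squares-balance {a} {b} {a′} {b′} eq b≤a′ b≤b′
  with m+[n∸m]≡n b≤a′ | m+[n∸m]≡n b≤b′
... | p | q = δ , ε , sym p , sym q , (begin
  a′ * a′ + b′ * b′ + 2 * (δ * ε)
    ≡⟨ cong₂ (λ y z → y * y + z * z + 2 * (δ * ε)) (sym p) (sym q) ⟩
  (b + δ) * (b + δ) + (b + ε) * (b + ε) + 2 * (δ * ε)
    ≡⟨ solve 3 (λ a d e →
         (a :+ d) :* (a :+ d) :+ (a :+ e) :* (a :+ e) :+ con 2 :* (d :* e) :=
         (a :+ d :+ e) :* (a :+ d :+ e) :+ a :* a) refl b δ ε ⟩
  (b + δ + ε) * (b + δ + ε) + b * b
    ≡⟨ cong (λ z → z * z + b * b) (sym a≡) ⟩
  a * a + b * b ∎)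
  where
  open ≡-Reasoning
  δ = a′ ∸ b
  ε = b′ ∸ b
  a≡ : a ≡ b + δ + ε
  a≡ = +-cancelʳ-≡ b a (b + δ + ε) (begin
    a + b              ≡⟨ sym eq ⟩
    a′ + b′            ≡⟨ cong₂ _+_ (sym (m+[n∸m]≡n b≤a′)) (sym (m+[n∸m]≡n b≤b′)) ⟩
    (b + δ) + (b + ε)  ≡⟨ solve 3 (λ a d e → (a :+ d) :+ (a :+ e) := a :+ d :+ e :+ a) refl b δ ε ⟩
    b + δ + ε + b      ∎)

squares-≤ : ∀ {a b a′ b′} → a′ + b′ ≡ a + b → b ≤ a′ → b ≤ b′ →
            a′ * a′ + b′ * b′ ≤ a * a + b * b
squares-≤ {a} {b} eq p q with squares-balance {a} {b} eq p q
... | δ , ε , _ , _ , e = ≤-trans (m≤m+n _ _) (≤-reflexive e)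

-- Here `δ` and `ε` are both positive, so the cross term `2 * (δ * ε)` is a strict loss.
squares-< : ∀ {a b a′ b′} → a′ + b′ ≡ a + b → b < a′ → b < b′ →
            a′ * a′ + b′ * b′ < a * a + b * b
squares-< {a} {b} {a′} {b′} eq p q with squares-balance {a} {b} eq (<⇒≤ p) (<⇒≤ q)
... | zero , _ , a′≡ , _ , _ = contradiction (trans a′≡ (+-identityʳ b)) (>⇒≢ p)
... | suc δ , zero , _ , b′≡ , _ = contradiction (trans b′≡ (+-identityʳ b)) (>⇒≢ q)
... | suc δ , suc ε , _ , _ , e =
  <-≤-trans (m<m+n (a′ * a′ + b′ * b′) (s≤s z≤n)) (≤-reflexive e)

-- Counting in decidable subsets of `Fin n`.

private variable
  n : ℕ
  P P′ : Fin n → Set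

𝟙 : {X : Set} → Dec X → ℕ
𝟙 (yes _) = 1
𝟙 (no _) = 0

𝟙-yes : {X : Set} (X? : Dec X) → X → 𝟙 X? ≡ 1
𝟙-yes (yes _) _ = refl
𝟙-yes (no ¬x) x = contradiction x ¬x

𝟙-no : {X : Set} (X? : Dec X) → ¬ X → 𝟙 X? ≡ 0
𝟙-no (yes x) ¬x = contradiction x ¬x
𝟙-no (no _) _ = refl

𝟙-mono : {X Y : Set} (X? : Dec X) (Y? : Dec Y) → (X → Y) → 𝟙 X? ≤ 𝟙 Y?
𝟙-mono (yes x) Y? f = ≤-reflexive (sym (𝟙-yes Y? (f x)))
𝟙-mono (no _) Y? f = z≤n

𝟙-cong : {X Y : Set} (X? : Dec X) (Y? : Dec Y) → (X → Y) → (Y → X) → 𝟙 X? ≡ 𝟙 Y?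
𝟙-cong X? Y? f g = ≤-antisym (𝟙-mono X? Y? f) (𝟙-mono Y? X? g)

♯ : Decidable P → ℕ
♯ P? = sum (λ i → 𝟙 (P? i))

♯-mono : (P? : Decidable P) (P′? : Decidable P′) → P ⊆ P′ → ♯ P? ≤ ♯ P′?
♯-mono P? P′? f = sum-mono (λ i → 𝟙-mono (P? i) (P′? i) f)

♯-mono-< : (P? : Decidable P) (P′? : Decidable P′) → P ⊆ P′ →
           ∀ {a} → P′ a → ¬ P a → ♯ P? < ♯ P′?
♯-mono-< P? P′? f {a} q ¬p = sum-mono-< (λ i → 𝟙-mono (P? i) (P′? i) f) a
  (subst₂ _<_ (sym (𝟙-no (P? a) ¬p)) (sym (𝟙-yes (P′? a) q)) (s≤s z≤n))

♯-cong : (P? : Decidable P) (P′? : Decidable P′) → P ⊆ P′ → P′ ⊆ P → ♯ P? ≡ ♯ P′?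
♯-cong P? P′? f g = ≤-antisym (♯-mono P? P′? f) (♯-mono P′? P? g)

♯-empty : ∀ {n} {P : Fin n → Set} (P? : Decidable P) → (∀ i → ¬ P i) → ♯ P? ≡ 0
♯-empty {n = zero} P? ¬p = refl
♯-empty {n = suc n} P? ¬p = cong₂ _+_ (𝟙-no (P? zero) (¬p zero)) (♯-empty (P? ∘ suc) (¬p ∘ suc))

♯-inhabited : ∀ {n} {P : Fin n → Set} (P? : Decidable P) → 1 ≤ ♯ P? → ∃ P
♯-inhabited {n = suc n} P? le with P? zero
... | yes p = zero , p
... | no _ with ♯-inhabited (P? ∘ suc) le
... | i , p = suc i , p

_∖_ : {A : Set} → (A → Set) → A → A → Set
(P ∖ a) i = P i × i ≢ a

delete : Decidable P → ∀ a → Decidable (P ∖ a)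
delete P? a i = P? i ×-dec ¬? (i ≟ a)

♯-delete : (P? : Decidable P) → ∀ {a} → P a → ♯ P? ≡ suc (♯ (delete P? a))
♯-delete P? {a} p = begin
  ♯ P?                               ≡⟨ sym (+-identityʳ _) ⟩
  ♯ P? + 0                           ≡⟨ cong (♯ P? +_) (sym (𝟙-no (delete P? a a) λ q → proj₂ q refl)) ⟩
  ♯ P? + 𝟙 (delete P? a a)           ≡⟨ sum-replace a (λ i i≢a → 𝟙-cong (P? i) (delete P? a i) (_, i≢a) proj₁) ⟩
  ♯ (delete P? a) + 𝟙 (P? a)         ≡⟨ cong (♯ (delete P? a) +_) (𝟙-yes (P? a) p) ⟩
  ♯ (delete P? a) + 1                ≡⟨ +-comm _ 1 ⟩
  suc (♯ (delete P? a))              ∎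
  where open ≡-Reasoning

♯-singleton : (a : Fin n) → ♯ (λ i → a ≟ i) ≡ 1
♯-singleton a = trans (♯-delete (λ i → a ≟ i) refl)
  (cong suc (♯-empty (delete (λ i → a ≟ i) a) λ i (p , q) → q (sym p)))

-- Induction on the size of `P`: after deleting `a` from `P` and `f a` from `Q`, injectivity keeps
-- the remaining images away from `f a`.
♯-inject : ∀ {n} {P Q : Fin n → Set} (P? : Decidable P) (Q? : Decidable Q) (f : Fin n → Fin n) →
           (∀ {i} → P i → Q (f i)) → (∀ {i j} → P i → P j → f i ≡ f j → i ≡ j) →
           ♯ P? ≤ ♯ Q?
♯-inject {n} P? Q? f = go (♯ P?) P? Q? refl
  where
  go : ∀ m {P Q : Fin n → Set} (P? : Decidable P) (Q? : Decidable Q) → ♯ P? ≡ m →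
       (∀ {i} → P i → Q (f i)) → (∀ {i j} → P i → P j → f i ≡ f j → i ≡ j) → ♯ P? ≤ ♯ Q?
  go zero P? Q? eq maps inj = subst (_≤ ♯ Q?) (sym eq) z≤n
  go (suc m) P? Q? eq maps inj with ♯-inhabited P? (subst (1 ≤_) (sym eq) (s≤s z≤n))
  ... | a , pa = subst₂ _≤_ (sym (♯-delete P? pa)) (sym (♯-delete Q? (maps pa)))
    (s≤s (go m (delete P? a) (delete Q? (f a))
      (suc-injective (trans (sym (♯-delete P? pa)) eq))
      (λ (p , i≢a) → maps p , λ e → i≢a (inj p pa e))
      (λ (p , _) (q , _) → inj p q)))

♯-split : ∀ {R : Fin n → Set} (P? : Decidable P) (P′? : Decidable P′) (R? : Decidable R) →
          (∀ {i} → P i → P′ i ⊎ R i) → P′ ⊆ P → R ⊆ P → (∀ {i} → P′ i → ¬ R i) →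
          ♯ P? ≡ ♯ P′? + ♯ R?
♯-split P? P′? R? split q r disjoint = trans (sum-cong-≗ pointwise) (∑-distrib-+ (λ i → 𝟙 (P′? i)) (λ i → 𝟙 (R? i)))
  where
  pointwise : ∀ i → 𝟙 (P? i) ≡ 𝟙 (P′? i) + 𝟙 (R? i)
  pointwise i with P? i | P′? i | R? i
  ... | yes p | yes _ | no _ = refl
  ... | yes p | no _ | yes _ = refl
  ... | yes p | yes x | yes y = contradiction y (disjoint x)
  ... | yes p | no x | no y with split p
  ... | inj₁ z = contradiction z x
  ... | inj₂ z = contradiction z y
  pointwise i | no p | yes x | _ = contradiction (q x) p
  pointwise i | no p | no _ | yes y = contradiction (r y) p
  pointwise i | no p | no _ | no _ = refl

-- Trails generated by two involutions.

-- τ matches the two halves of an edge and π matches halves at a common vertex;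
-- the fixed points of π are the ends of trails.
record Trail {A : Set} (τ π : A → A) (D : A → Set) (h : A) : Set₁ where
  field
    F : A → Set
    F? : Decidable F
    F⊆D : F ⊆ D
    closed-τ : ∀ {y} → F y → F (τ y)
    closed-π : ∀ {y} → F y → F (π y)
    start : F h
    end : A
    end∈F : F end
    end-fixed : π end ≡ end
    end≢start : end ≢ h
    only-ends : ∀ {y} → F y → π y ≡ y → y ≡ h ⊎ y ≡ end
    least : (C : A → Set) → (∀ {y} → D y → C y → C (τ y)) → (∀ {y} → D y → C y → C (π y)) →
            C h → F ⊆ C

module Trails {A : Set} (_≟_ : DecidableEquality A)
  (size : ∀ {D : A → Set} → Decidable D → ℕ)
  (remove : ∀ {D : A → Set} → Decidable D → ∀ a → Decidable (D ∖ a))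
  (size-remove : ∀ {D : A → Set} (D? : Decidable D) {a} → D a → size (remove D? a) < size D?)
  (τ : A → A) (ττ : ∀ y → τ (τ y) ≡ y) where

  -- Following the trail from h for two steps leads to b = π (τ h); deleting h and τ h
  -- and declaring b an end reduces the domain.
  trail : ∀ {D : A → Set} (D? : Decidable D) → Acc _<_ (size D?) →
          (∀ {y} → D y → D (τ y)) → (∀ {y} → D y → τ y ≢ y) →
          (π : A → A) → (∀ y → π (π y) ≡ y) → (∀ {y} → D y → D (π y)) →
          ∀ {h} → D h → π h ≡ h → Trail τ π D h
  trail {D} D? (acc rec) Dτ τ≢ π ππ Dπ {h} Dh πh with π (τ h) ≟ τ h
  ... | yes fixed = record
    { F = λ y → y ≡ h ⊎ y ≡ τ h
    ; F? = λ y → (y ≟ h) ⊎-dec (y ≟ τ h)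
    ; F⊆D = λ { (inj₁ refl) → Dh ; (inj₂ refl) → Dτ Dh }
    ; closed-τ = λ { (inj₁ refl) → inj₂ refl ; (inj₂ refl) → inj₁ (ττ _) }
    ; closed-π = λ { (inj₁ refl) → inj₁ πh ; (inj₂ refl) → inj₂ fixed }
    ; start = inj₁ refl
    ; end = τ h
    ; end∈F = inj₂ refl
    ; end-fixed = fixed
    ; end≢start = τ≢ Dh
    ; only-ends = λ p _ → p
    ; least = λ { C Cτ _ Ch (inj₁ refl) → Ch ; C Cτ _ Ch (inj₂ refl) → Cτ Dh Ch }
    }
  ... | no moved = record
    { F = λ y → y ≡ h ⊎ y ≡ t ⊎ T.F y
    ; F? = λ y → (y ≟ h) ⊎-dec (y ≟ t) ⊎-dec (T.F? y)
    ; F⊆D = λ { (inj₁ refl) → Dh ; (inj₂ (inj₁ refl)) → Dτ Dh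
              ; (inj₂ (inj₂ p)) → proj₁ (proj₁ (T.F⊆D p)) }
    ; closed-τ = λ { (inj₁ refl) → inj₂ (inj₁ refl) ; (inj₂ (inj₁ refl)) → inj₁ (ττ _)
                   ; (inj₂ (inj₂ p)) → inj₂ (inj₂ (T.closed-τ p)) }
    ; closed-π = λ { (inj₁ refl) → inj₁ πh ; (inj₂ (inj₁ refl)) → inj₂ (inj₂ T.start)
                   ; (inj₂ (inj₂ p)) → closed-π p }
    ; start = inj₁ refl
    ; end = T.end
    ; end∈F = inj₂ (inj₂ T.end∈F)
    ; end-fixed = trans (sym (π′-other T.end≢start (proj₂ (T.F⊆D T.end∈F)))) T.end-fixed
    ; end≢start = proj₂ (proj₁ (T.F⊆D T.end∈F))
    ; only-ends = λ { (inj₁ refl) _ → inj₁ refl ; (inj₂ (inj₁ refl)) e → contradiction e moved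
                    ; (inj₂ (inj₂ p)) e → inj₂ (only-ends p e) }
    ; least = λ { C Cτ Cπ Ch (inj₁ refl) → Ch
                ; C Cτ Cπ Ch (inj₂ (inj₁ refl)) → Cτ Dh Ch
                ; C Cτ Cπ Ch (inj₂ (inj₂ p)) → least C Cτ Cπ Ch p }
    }
    where
    t = τ h
    b = π t

    D′? = remove (remove D? h) t

    D′ : A → Set
    D′ = (D ∖ h) ∖ t

    b≢h : b ≢ h
    b≢h e = τ≢ Dh (trans (sym (ππ t)) (trans (cong π e) πh))

    πb≢b : π b ≢ b
    πb≢b e = moved (sym (trans (sym (ππ t)) e))

    -- `π` exchanges `t` and `b`, so once `b` is declared an end, `t` has to be fixed too if `π′` is
    -- to remain an involution; `t` itself lies outside `D′`.
    π′ : A → A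
    π′ y with y ≟ b | y ≟ t
    ... | yes _ | _ = b
    ... | no _ | yes _ = t
    ... | no _ | no _ = π y

    π′b : π′ b ≡ b
    π′b with b ≟ b | b ≟ t
    ... | yes _ | _ = refl
    ... | no ne | _ = contradiction refl ne

    π′t : π′ t ≡ t
    π′t with t ≟ b | t ≟ t
    ... | yes e | _ = sym e
    ... | no _ | yes _ = refl
    ... | no _ | no ne = contradiction refl ne

    π′-other : ∀ {y} → y ≢ b → y ≢ t → π′ y ≡ π y
    π′-other {y} y≢b y≢t with y ≟ b | y ≟ t
    ... | yes e | _ = contradiction e y≢b
    ... | no _ | yes e = contradiction e y≢t
    ... | no _ | no _ = refl

    πy≢b : ∀ {y} → y ≢ t → π y ≢ b
    πy≢b y≢t e = y≢t (trans (sym (ππ _)) (trans (cong π e) (ππ t)))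

    πy≢t : ∀ {y} → y ≢ b → π y ≢ t
    πy≢t y≢b e = y≢b (trans (sym (ππ _)) (cong π e))

    π′π′ : ∀ y → π′ (π′ y) ≡ y
    π′π′ y with y ≟ b | y ≟ t
    ... | yes refl | _ = π′b
    ... | no _ | yes refl = π′t
    ... | no y≢b | no y≢t = trans (π′-other (πy≢b y≢t) (πy≢t y≢b)) (ππ y)

    D′b : D′ b
    D′b = (Dπ (Dτ Dh) , b≢h) , moved

    D′π′ : ∀ {y} → D′ y → D′ (π′ y)
    D′π′ {y} ((d , y≢h) , y≢t) with y ≟ b | y ≟ t
    ... | yes refl | _ = D′b
    ... | no _ | yes e = contradiction e y≢t
    ... | no y≢b | no _ =
      (Dπ d , λ e → y≢h (trans (sym (ππ y)) (trans (cong π e) πh))) , πy≢t y≢b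

    D′τ : ∀ {y} → D′ y → D′ (τ y)
    D′τ {y} ((d , y≢h) , y≢t) =
      (Dτ d , λ e → y≢t (trans (sym (ττ y)) (cong τ e))) ,
      λ e → y≢h (trans (sym (ττ y)) (trans (cong τ e) (ττ h)))

    T : Trail τ π′ D′ b
    T = trail D′? (rec (<-trans (size-remove (remove D? h) (Dτ Dh , τ≢ Dh)) (size-remove D? Dh)))
          D′τ (λ ((d , _) , _) → τ≢ d) π′ π′π′ D′π′ D′b π′b
    module T = Trail T

    closed-π : ∀ {y} → T.F y → π y ≡ h ⊎ π y ≡ t ⊎ T.F (π y)
    closed-π {y} p with y ≟ b
    ... | yes refl = inj₂ (inj₁ (ππ t))
    ... | no y≢b = inj₂ (inj₂ (subst T.F (π′-other y≢b (proj₂ (T.F⊆D p))) (T.closed-π p)))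

    -- The start `b` of the shorter trail is an end for `π′` only; `π` pairs it with `t`.
    only-ends : ∀ {y} → T.F y → π y ≡ y → y ≡ T.end
    only-ends {y} p e with y ≟ b
    ... | yes refl = contradiction e πb≢b
    ... | no y≢b with T.only-ends p (trans (π′-other y≢b (proj₂ (T.F⊆D p))) e)
    ... | inj₁ y≡b = contradiction y≡b y≢b
    ... | inj₂ y≡end = y≡end

    least : (C : A → Set) → (∀ {y} → D y → C y → C (τ y)) → (∀ {y} → D y → C y → C (π y)) →
            C h → T.F ⊆ C
    least C Cτ Cπ Ch = T.least C (λ ((d , _) , _) → Cτ d) Cπ′ (Cπ (Dτ Dh) (Cτ Dh Ch))
      where
      Cπ′ : ∀ {y} → D′ y → C y → C (π′ y)
      Cπ′ {y} ((d , _) , y≢t) cy with y ≟ b | y ≟ t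
      ... | yes refl | _ = cy
      ... | no _ | yes e = contradiction e y≢t
      ... | no _ | no _ = Cπ d cy

module _ {A : Set} {τ π : A → A} {D : A → Set}
  (ττ : ∀ y → τ (τ y) ≡ y) (ππ : ∀ y → π (π y) ≡ y) where

  open Trail

  -- The complement of the first trail is closed, so it would contain the second one.
  end-injective : ∀ {h h′} → D h′ → π h′ ≡ h′ →
                  (T : Trail τ π D h) (T′ : Trail τ π D h′) → end T ≡ end T′ → h ≡ h′
  end-injective {h} {h′} Dh′ πh′ T T′ e with F? T h′
  ... | yes p with only-ends T p πh′
  ... | inj₁ h′≡h = sym h′≡h
  ... | inj₂ h′≡end = contradiction (trans (sym e) (sym h′≡end)) (end≢start T′)
  end-injective {h} {h′} Dh′ πh′ T T′ e | no ¬p =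
    contradiction (end∈F T) (subst (λ z → ¬ F T z) (sym e) (least T′ (λ y → ¬ F T y)
      (λ _ ¬q q → ¬q (subst (F T) (ττ _) (closed-τ T q)))
      (λ _ ¬q q → ¬q (subst (F T) (ππ _) (closed-π T q))) ¬p (end∈F T′)))

-- Matchings of disjoint sets of equal size.

record Matching {n} (K J : Fin n → Set) : Set where
  field
    π : Fin n → Fin n
    ππ : ∀ y → π (π y) ≡ y
    K→J : ∀ {y} → K y → J (π y)
    J→K : ∀ {y} → J y → K (π y)
    fixed : ∀ {y} → ¬ K y → ¬ J y → π y ≡ y

-- One pair `a`, `b` is spliced into a matching of the remaining elements, which fixes both. The
-- result is an involution of all of `Fin n`, so it can serve as the pairing of a trail at one
-- vertex.
matching : ∀ {n} m {K J : Fin n → Set} (K? : Decidable K) (J? : Decidable J) →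
           ♯ K? ≡ m → ♯ J? ≡ m → (∀ {y} → K y → ¬ J y) → Matching K J
matching zero {K} {J} K? J? k j disjoint = record
  { π = id ; ππ = λ _ → refl
  ; K→J = λ {y} p → contradiction p (empty K? k y)
  ; J→K = λ {y} p → contradiction p (empty J? j y)
  ; fixed = λ _ _ → refl }
  where
  empty : ∀ {P : Fin _ → Set} (P? : Decidable P) → ♯ P? ≡ 0 → ∀ y → ¬ P y
  empty P? e y p with trans (sym e) (♯-delete P? p)
  ... | ()
matching (suc m) {K} {J} K? J? k j disjoint
  with ♯-inhabited K? (subst (1 ≤_) (sym k) (s≤s z≤n)) | ♯-inhabited J? (subst (1 ≤_) (sym j) (s≤s z≤n))
... | a , Ka | b , Jb = record
  { π = π ; ππ = ππ ; K→J = K→J ; J→K = J→K ; fixed = fixed }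
  where
  M : Matching (K ∖ a) (J ∖ b)
  M = matching m (delete K? a) (delete J? b)
        (suc-injective (trans (sym (♯-delete K? Ka)) k))
        (suc-injective (trans (sym (♯-delete J? Jb)) j))
        (λ (p , _) (q , _) → disjoint p q)
  module M = Matching M

  a≢b : a ≢ b
  a≢b refl = disjoint Ka Jb

  Ma : M.π a ≡ a
  Ma = M.fixed (λ p → proj₂ p refl) (λ (p , _) → disjoint Ka p)

  Mb : M.π b ≡ b
  Mb = M.fixed (λ (p , _) → disjoint p Jb) (λ p → proj₂ p refl)

  π : Fin _ → Fin _
  π y with y ≟ a | y ≟ b
  ... | yes _ | _ = b
  ... | no _ | yes _ = a
  ... | no _ | no _ = M.π y

  πa : π a ≡ b
  πa with a ≟ a | a ≟ b
  ... | yes _ | _ = refl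
  ... | no ne | _ = contradiction refl ne

  πb : π b ≡ a
  πb with b ≟ a | b ≟ b
  ... | yes e | _ = e
  ... | no _ | yes _ = refl
  ... | no _ | no ne = contradiction refl ne

  π-other : ∀ {y} → y ≢ a → y ≢ b → π y ≡ M.π y
  π-other {y} p q with y ≟ a | y ≟ b
  ... | yes e | _ = contradiction e p
  ... | no _ | yes e = contradiction e q
  ... | no _ | no _ = refl

  ππ : ∀ y → π (π y) ≡ y
  ππ y with y ≟ a | y ≟ b
  ... | yes refl | _ = πb
  ... | no _ | yes refl = πa
  ... | no p | no q = trans (π-other
    (λ e → p (trans (sym (M.ππ y)) (trans (cong M.π e) Ma)))
    (λ e → q (trans (sym (M.ππ y)) (trans (cong M.π e) Mb)))) (M.ππ y)

  K→J : ∀ {y} → K y → J (π y)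
  K→J {y} p with y ≟ a | y ≟ b
  ... | yes _ | _ = Jb
  ... | no _ | yes refl = contradiction Jb (disjoint p)
  ... | no ne | no _ = proj₁ (M.K→J (p , ne))

  J→K : ∀ {y} → J y → K (π y)
  J→K {y} p with y ≟ a | y ≟ b
  ... | yes refl | _ = contradiction p (disjoint Ka)
  ... | no _ | yes _ = Ka
  ... | no _ | no ne = proj₁ (M.J→K (p , ne))

  fixed : ∀ {y} → ¬ K y → ¬ J y → π y ≡ y
  fixed {y} p q with y ≟ a | y ≟ b
  ... | yes refl | _ = contradiction Ka p
  ... | no _ | yes refl = contradiction Jb q
  ... | no _ | no _ = M.fixed (p ∘ proj₁) (q ∘ proj₁)

-- Transposing two colours.

module _ {m} (k j : Fin m) where

  transpose-matchˡ : transpose k j k ≡ j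
  transpose-matchˡ with k ≟ k
  ... | yes _ = refl
  ... | no ne = contradiction refl ne

  transpose-matchʳ : transpose k j j ≡ k
  transpose-matchʳ with j ≟ k
  ... | yes e = e
  ... | no _ with j ≟ j
  ... | yes _ = refl
  ... | no ne = contradiction refl ne

  transpose-mismatch : ∀ {l} → l ≢ k → l ≢ j → transpose k j l ≡ l
  transpose-mismatch {l} p q with l ≟ k
  ... | yes e = contradiction e p
  ... | no _ with l ≟ j
  ... | yes e = contradiction e q
  ... | no _ = refl

  transpose-involutive : ∀ l → transpose k j (transpose k j l) ≡ l
  transpose-involutive l = go (l ≟ k) (l ≟ j)
    where
    go : Dec (l ≡ k) → Dec (l ≡ j) → transpose k j (transpose k j l) ≡ l
    go (yes refl) _ = trans (cong (transpose k j) transpose-matchˡ) transpose-matchʳ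
    go (no _) (yes refl) = trans (cong (transpose k j) transpose-matchʳ) transpose-matchˡ
    go (no p) (no q) = trans (cong (transpose k j) (transpose-mismatch p q)) (transpose-mismatch p q)

-- Colour classes and partially balanced colourings.

module Counts {n : ℕ} (G : Graph n) {x : ℕ} where

  Adj : Fin n → Fin n → Set
  Adj w u = adj G w u ≡ true

  Adj? : ∀ w → Decidable (Adj w)
  Adj? w u = adj G w u Bool.≟ true

  Adj-sym : ∀ {w u} → Adj w u → Adj u w
  Adj-sym {w} {u} e = trans (adj-sym G u w) e

  Adj-irrefl : ∀ {w u} → Adj w u → w ≢ u
  Adj-irrefl {w} e refl with trans (sym e) (irrefl G w)
  ... | ()

  Class : (Fin n → Fin n → Fin x) → Fin x → Fin n → Fin n → Set
  Class c l w u = Adj w u × c w u ≡ l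

  Class? : ∀ c l w → Decidable (Class c l w)
  Class? c l w u = Adj? w u ×-dec (c w u ≟ l)

  cnt : (Fin n → Fin n → Fin x) → Fin x → Fin n → ℕ
  cnt c l w = ♯ (Class? c l w)

  -- Balance is demanded only on `S`, which lets the balanced set grow by one vertex at a time.
  record State (S : Fin n → Set) : Set where
    field
      colour : Fin n → Fin n → Fin x
      colour-sym : ∀ w u → colour w u ≡ colour u w
      balanced : ∀ {w} → S w → ∀ l l′ → cnt colour l w ≤ suc (cnt colour l′ w)

-- Pairing the edges of two colours at each vertex.

module Recolour {n : ℕ} (G : Graph n) {x : ℕ} (S : Fin n → Set) (S? : Decidable S)
  (v : Fin n) (v∉S : ¬ S v) where

  open Counts G {x} public
  open State public

  count : State S → Fin x → Fin n → ℕ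
  count s = cnt (colour s)

  leaf : State S → Fin n → Fin x
  leaf s = colour s v

  -- The primary potential `low` counts these edges. Exchanges on trails never raise it (`low-≤`),
  -- and a shift whose trail does not stop where intended lowers it.
  LowAt : State S → Fin n → Set
  LowAt s u = S u × Adj v u × (∀ l → count s (leaf s u) u ≤ count s l u)

  LowAt? : ∀ s → Decidable (LowAt s)
  LowAt? s u = S? u ×-dec (Adj? v u ×-dec all? (λ l → count s (leaf s u) u ≤? count s l u))

  low : State S → ℕ
  low s = ♯ (LowAt? s)

  module Flip (s : State S) {k j : Fin x} (k≢j : k ≢ j) where

    private
      c = colour s

    tr : Fin x → Fin x
    tr = transpose k j

    tr-tr : ∀ l → tr (tr l) ≡ l
    tr-tr = transpose-involutive k j

    KJ : Fin x → Set
    KJ l = l ≡ k ⊎ l ≡ j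

    KJ? : Decidable KJ
    KJ? l = (l ≟ k) ⊎-dec (l ≟ j)

    tr-fixes : ∀ {l} → ¬ KJ l → tr l ≡ l
    tr-fixes p = transpose-mismatch k j (p ∘ inj₁) (p ∘ inj₂)

    tr-KJ : ∀ {l} → KJ l → KJ (tr l)
    tr-KJ (inj₁ refl) = inj₂ (transpose-matchˡ k j)
    tr-KJ (inj₂ refl) = inj₁ (transpose-matchʳ k j)

    tr-moves : ∀ {l} → KJ l → l ≢ tr l
    tr-moves (inj₁ refl) e = k≢j (trans e (transpose-matchˡ k j))
    tr-moves (inj₂ refl) e = k≢j (sym (trans e (transpose-matchʳ k j)))

    KJ-cases : ∀ {l a} → KJ l → KJ a → l ≡ a ⊎ l ≡ tr a
    KJ-cases (inj₁ refl) (inj₁ refl) = inj₁ refl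
    KJ-cases (inj₁ refl) (inj₂ refl) = inj₂ (sym (transpose-matchʳ k j))
    KJ-cases (inj₂ refl) (inj₁ refl) = inj₂ (sym (transpose-matchˡ k j))
    KJ-cases (inj₂ refl) (inj₂ refl) = inj₁ refl

    -- The pair `(w , u)` encodes the half at `w` of the edge `wu`. Thus `swap` passes to the other
    -- half of the same edge, and `Π` to another half at the same vertex.
    D : Fin n × Fin n → Set
    D (w , u) = Adj w u × KJ (c w u)

    D? : Decidable D
    D? (w , u) = Adj? w u ×-dec KJ? (c w u)

    -- If the edge from w to v is in the majority class at w, it must be the unpaired one.
    data Kind (w : Fin n) (π : Fin n → Fin n) : Set where
      even : (∀ {u} → D (w , u) → π u ≢ u) → (∀ l → cnt c (tr l) w ≡ cnt c l w) → Kind w π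
      odd : ∀ {e} → D (w , e) → π e ≡ e → (∀ {u} → D (w , u) → π u ≡ u → u ≡ e) →
            cnt c (c w e) w ≡ suc (cnt c (tr (c w e)) w) →
            (Adj w v → c w v ≡ c w e → v ≡ e) → Kind w π

    -- At a vertex of `S` the two class sizes differ by at most one, so edges of opposite colours
    -- can be paired with at most one edge left over. Outside `S`, hence at `v`, nothing is paired
    -- and every half-edge is a trail end.
    record Pairing (w : Fin n) : Set where
      field
        π : Fin n → Fin n
        ππ : ∀ u → π (π u) ≡ u
        swaps : ∀ {u} → D (w , u) → π u ≢ u → D (w , π u) × c w (π u) ≡ tr (c w u)
        kind : S w → Kind w π
        free : ¬ S w → ∀ u → π u ≡ u

    private
      disjoint : ∀ {a w u} → KJ a → Class c a w u → ¬ Class c (tr a) w u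
      disjoint kj (_ , p) (_ , q) = tr-moves kj (trans (sym p) q)

    evenPairing : ∀ {w} → S w → cnt c k w ≡ cnt c j w → Pairing w
    evenPairing {w} Sw e = record
      { π = M.π
      ; ππ = M.ππ
      ; swaps = λ d _ → swaps d
      ; kind = λ _ → even (λ d f → tr-moves (proj₂ d) (trans (sym (cong (c w) f)) (proj₂ (swaps d))))
                          (λ l → counts l (l ≟ k) (l ≟ j))
      ; free = contradiction Sw
      }
      where
      module M = Matching (matching (cnt c j w) (Class? c k w) (Class? c j w) e refl
                   (λ (_ , p) (_ , q) → k≢j (trans (sym p) q)))
      swaps : ∀ {u} → D (w , u) → D (w , M.π u) × c w (M.π u) ≡ tr (c w u)
      swaps (a , inj₁ p) with M.K→J (a , p)
      ... | a′ , p′ = (a′ , inj₂ p′) , trans p′ (sym (trans (cong tr p) (transpose-matchˡ k j)))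
      swaps (a , inj₂ p) with M.J→K (a , p)
      ... | a′ , p′ = (a′ , inj₁ p′) , trans p′ (sym (trans (cong tr p) (transpose-matchʳ k j)))
      counts : ∀ l → Dec (l ≡ k) → Dec (l ≡ j) → cnt c (tr l) w ≡ cnt c l w
      counts l (yes refl) _ rewrite transpose-matchˡ k j = sym e
      counts l (no _) (yes refl) rewrite transpose-matchʳ k j = e
      counts l (no p) (no q) rewrite transpose-mismatch k j p q = refl

    -- Withholding the majority edge `e` makes the two classes equal in size, and the rest is
    -- matched completely.
    oddPairing : ∀ {w a} → S w → KJ a → cnt c a w ≡ suc (cnt c (tr a) w) →
                 ∀ {e} → Class c a w e → (Adj w v → c w v ≡ a → v ≡ e) → Pairing w
    oddPairing {w} {a} Sw kj eq {e} (we , refl) prefer = record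
      { π = M.π
      ; ππ = M.ππ
      ; swaps = λ d ne → swaps d ne (KJ-cases (proj₂ d) kj)
      ; kind = λ _ → odd (we , kj) πe (λ d f → unique d f (KJ-cases (proj₂ d) kj)) eq prefer
      ; free = contradiction Sw
      }
      where
      module M = Matching (matching (cnt c (tr a) w) (Class? c (tr a) w) (delete (Class? c a w) e) refl
                   (suc-injective (trans (sym (♯-delete (Class? c a w) (we , refl))) eq))
                   (λ q (p , _) → disjoint kj p q))
      πe : M.π e ≡ e
      πe = M.fixed (disjoint kj (we , refl)) (λ p → proj₂ p refl)
      swaps : ∀ {u} → D (w , u) → M.π u ≢ u → c w u ≡ a ⊎ c w u ≡ tr a →
              D (w , M.π u) × c w (M.π u) ≡ tr (c w u)
      swaps {u} (d , _) ne (inj₁ p) with u ≟ e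
      ... | yes refl = contradiction πe ne
      ... | no u≢e with M.J→K ((d , p) , u≢e)
      ... | d′ , p′ = (d′ , subst KJ (sym p′) (tr-KJ kj)) , trans p′ (cong tr (sym p))
      swaps (d , _) ne (inj₂ p) with M.K→J (d , p)
      ... | (d′ , p′) , _ = (d′ , subst KJ (sym p′) kj) , trans p′ (sym (trans (cong tr p) (tr-tr a)))
      unique : ∀ {u} → D (w , u) → M.π u ≡ u → c w u ≡ a ⊎ c w u ≡ tr a → u ≡ e
      unique {u} (d , _) f (inj₁ p) with u ≟ e
      ... | yes u≡e = u≡e
      ... | no u≢e with M.J→K ((d , p) , u≢e)
      ... | q = contradiction (subst (Class c (tr a) w) f q) (disjoint kj (d , p))
      unique {u} (d , _) f (inj₂ p) with M.K→J (d , p)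
      ... | q , _ = contradiction (d , p) (disjoint kj (subst (Class c a w) f q))

    majorityPairing : ∀ {w a} → S w → KJ a → cnt c a w ≡ suc (cnt c (tr a) w) → Pairing w
    -- The edge to `v` is withheld whenever it has the majority colour; `level` depends on this
    -- choice.
    majorityPairing {w} {a} Sw kj eq with Class? c a w v
    ... | yes p = oddPairing Sw kj eq p (λ _ _ → refl)
    ... | no ¬p with ♯-inhabited (Class? c a w) (subst (1 ≤_) (sym eq) (s≤s z≤n))
    ... | e , p = oddPairing Sw kj eq p (λ d q → contradiction (d , q) ¬p)

    abstract
      pairing : ∀ w → Pairing w
      pairing w with S? w
      ... | no ¬Sw = record
        { π = id ; ππ = λ _ → refl ; swaps = λ _ ne → contradiction refl ne
        ; kind = λ Sw → contradiction Sw ¬Sw ; free = λ _ _ → refl }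
      ... | yes Sw with <-cmp (cnt c k w) (cnt c j w)
      ... | tri≈ _ e _ = evenPairing Sw e
      ... | tri< lt _ _ = majorityPairing Sw (inj₂ refl)
        (trans (≤-antisym (balanced s Sw j k) lt) (cong (λ l → suc (cnt c l w)) (sym (transpose-matchʳ k j))))
      ... | tri> _ _ gt = majorityPairing Sw (inj₁ refl)
        (trans (≤-antisym (balanced s Sw k j) gt) (cong (λ l → suc (cnt c l w)) (sym (transpose-matchˡ k j))))

    -- Alternating trails and exchanging two colours on them.

    π : Fin n → Fin n → Fin n
    π w = Pairing.π (pairing w)

    Π : Fin n × Fin n → Fin n × Fin n
    Π (w , u) = w , π w u

    ππ : ∀ w u → π w (π w u) ≡ u
    ππ w = Pairing.ππ (pairing w)

    π-free : ∀ {w} → ¬ S w → ∀ u → π w u ≡ u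
    π-free {w} = Pairing.free (pairing w)

    ΠΠ : ∀ y → Π (Π y) ≡ y
    ΠΠ (w , u) = cong (w ,_) (ππ w u)

    swap-swap : (y : Fin n × Fin n) → swap (swap y) ≡ y
    swap-swap (w , u) = refl

    D-swap : ∀ {y} → D y → D (swap y)
    D-swap {w , u} (a , p) = Adj-sym a , subst KJ (colour-sym s w u) p

    D-Π : ∀ {y} → D y → D (Π y)
    D-Π {w , u} d with π w u ≟ u
    ... | yes e = subst (λ z → D (w , z)) (sym e) d
    ... | no ne = proj₁ (Pairing.swaps (pairing w) d ne)

    private
      _≟ₚ_ : DecidableEquality (Fin n × Fin n)
      _≟ₚ_ = ≡-dec _≟_ _≟_

      size : {E : Fin n × Fin n → Set} → Decidable E → ℕ
      size E? = sum (λ w → ♯ (λ u → E? (w , u)))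

      remove : {E : Fin n × Fin n → Set} → Decidable E → ∀ a → Decidable (E ∖ a)
      remove E? a y = E? y ×-dec ¬? (y ≟ₚ a)

      size-remove : {E : Fin n × Fin n → Set} (E? : Decidable E) {a : Fin n × Fin n} →
                    E a → size (remove E? a) < size E?
      size-remove E? {w , u} p = sum-mono-<
        (λ w′ → ♯-mono (λ u′ → remove E? (w , u) (w′ , u′)) (λ u′ → E? (w′ , u′)) proj₁) w
        (♯-mono-< (λ u′ → remove E? (w , u) (w , u′)) (λ u′ → E? (w , u′)) proj₁ {u} p (λ q → proj₂ q refl))

    module T = Trails _≟ₚ_ size remove size-remove swap swap-swap

    abstract
      trail : ∀ {w u} → D (w , u) → π w u ≡ u → Trail swap Π D (w , u)
      trail {w} d e = T.trail D? (<-wellFounded _) D-swap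
        (λ { (a , _) f → Adj-irrefl a (sym (cong proj₁ f)) }) Π ΠΠ D-Π d (cong (w ,_) e)

    -- Only these closure properties are needed for an exchange. Unlike trails, closed sets admit
    -- unions, which allows exchanging on two trails at once even if they overlap.
    record Closed (F : Fin n × Fin n → Set) : Set where
      field
        F? : Decidable F
        F⊆D : F ⊆ D
        closed-τ : ∀ {y} → F y → F (swap y)
        closed-π : ∀ {y} → F y → F (Π y)

    closed : ∀ {h} (t : Trail swap Π D h) → Closed (Trail.F t)
    closed t = record { F? = F? ; F⊆D = F⊆D ; closed-τ = closed-τ ; closed-π = closed-π }
      where open Trail t

    union : ∀ {F F′} → Closed F → Closed F′ → Closed (λ y → F y ⊎ F′ y)
    union C C′ = record
      { F? = λ y → C.F? y ⊎-dec C′.F? y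
      ; F⊆D = λ { (inj₁ p) → C.F⊆D p ; (inj₂ p) → C′.F⊆D p }
      ; closed-τ = λ { (inj₁ p) → inj₁ (C.closed-τ p) ; (inj₂ p) → inj₂ (C′.closed-τ p) }
      ; closed-π = λ { (inj₁ p) → inj₁ (C.closed-π p) ; (inj₂ p) → inj₂ (C′.closed-π p) }
      }
      where
      module C = Closed C
      module C′ = Closed C′

    module Flipped {F : Fin n × Fin n → Set} (C : Closed F) where
      open Closed C

      private
        flipIf : {X : Set} → Dec X → Fin x → Fin x
        flipIf (yes _) = tr
        flipIf (no _) = id

        flipIf-cong : {X Y : Set} (X? : Dec X) (Y? : Dec Y) → (X → Y) → (Y → X) →
                      ∀ l → flipIf X? l ≡ flipIf Y? l
        flipIf-cong (yes _) (yes _) _ _ _ = refl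
        flipIf-cong (yes p) (no ¬q) f _ _ = contradiction (f p) ¬q
        flipIf-cong (no ¬p) (yes q) _ g _ = contradiction (g q) ¬p
        flipIf-cong (no _) (no _) _ _ _ = refl

      c′ : Fin n → Fin n → Fin x
      c′ w u = flipIf (F? (w , u)) (c w u)

      c′-in : ∀ {w u} → F (w , u) → c′ w u ≡ tr (c w u)
      c′-in {w} {u} p with F? (w , u)
      ... | yes _ = refl
      ... | no ¬p = contradiction p ¬p

      c′-out : ∀ {w u} → ¬ F (w , u) → c′ w u ≡ c w u
      c′-out {w} {u} ¬p with F? (w , u)
      ... | yes p = contradiction p ¬p
      ... | no _ = refl

      c′-sym : ∀ w u → c′ w u ≡ c′ u w
      c′-sym w u = trans (flipIf-cong (F? (w , u)) (F? (u , w)) closed-τ closed-τ (c w u))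
        (cong (flipIf (F? (u , w))) (colour-sym s w u))

      In? : ∀ l w → Decidable (λ u → Class c l w u × F (w , u))
      In? l w u = Class? c l w u ×-dec F? (w , u)

      Out? : ∀ l w → Decidable (λ u → Class c l w u × ¬ F (w , u))
      Out? l w u = Class? c l w u ×-dec ¬? (F? (w , u))

      -- Edges of colour `l` inside `F` leave the class and those of colour `tr l` inside `F` enter
      -- it; the rest stay.
      cnt-flipped : ∀ l w → cnt c′ l w + ♯ (In? l w) ≡ cnt c l w + ♯ (In? (tr l) w)
      cnt-flipped l w = begin
        cnt c′ l w + ♯ (In? l w)
          ≡⟨ cong (_+ ♯ (In? l w)) (♯-split (Class? c′ l w) (Out? l w) (In? (tr l) w)
               new out-new in-new (λ (_ , ¬p) (_ , p) → ¬p p)) ⟩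
        ♯ (Out? l w) + ♯ (In? (tr l) w) + ♯ (In? l w)
          ≡⟨ +-comm _ (♯ (In? l w)) ⟩
        ♯ (In? l w) + (♯ (Out? l w) + ♯ (In? (tr l) w))
          ≡⟨ sym (+-assoc (♯ (In? l w)) _ _) ⟩
        ♯ (In? l w) + ♯ (Out? l w) + ♯ (In? (tr l) w)
          ≡⟨ cong (_+ ♯ (In? (tr l) w)) (sym (♯-split (Class? c l w) (In? l w) (Out? l w)
               old proj₁ proj₁ (λ (_ , p) (_ , ¬p) → ¬p p))) ⟩
        cnt c l w + ♯ (In? (tr l) w) ∎
        where
        open ≡-Reasoning
        old : ∀ {u} → Class c l w u → (Class c l w u × F (w , u)) ⊎ (Class c l w u × ¬ F (w , u))
        old {u} p with F? (w , u)
        ... | yes f = inj₁ (p , f)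
        ... | no ¬f = inj₂ (p , ¬f)
        new : ∀ {u} → Class c′ l w u →
              (Class c l w u × ¬ F (w , u)) ⊎ (Class c (tr l) w u × F (w , u))
        new {u} (a , p) with F? (w , u)
        ... | yes f = inj₂ ((a , trans (sym (tr-tr (c w u))) (cong tr p)) , f)
        ... | no ¬f = inj₁ ((a , p) , ¬f)
        out-new : ∀ {u} → Class c l w u × ¬ F (w , u) → Class c′ l w u
        out-new ((a , p) , ¬f) = a , trans (c′-out ¬f) p
        in-new : ∀ {u} → Class c (tr l) w u × F (w , u) → Class c′ l w u
        in-new ((a , p) , f) = a , trans (c′-in f) (trans (cong tr p) (tr-tr l))

      private
        π-injective : ∀ w {u u′} → π w u ≡ π w u′ → u ≡ u′
        π-injective w {u} {u′} e = trans (sym (ππ w u)) (trans (cong (π w) e) (ππ w u′))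

        paired : ∀ {w l u} → Class c l w u → F (w , u) → π w u ≢ u →
                 Class c (tr l) w (π w u) × F (w , π w u)
        paired {w} (a , refl) f ne with Pairing.swaps (pairing w) (F⊆D f) ne
        ... | (a′ , _) , p = (a′ , p) , closed-π f

      -- At such a vertex `π` injects the `l`-edges of `F` into its `tr l`-edges and vice versa, so
      -- the exchange cancels out.
      unchanged : ∀ {w} → (∀ {u} → F (w , u) → π w u ≢ u) → ∀ l → cnt c′ l w ≡ cnt c l w
      unchanged {w} moved l = +-cancelʳ-≡ (♯ (In? l w)) _ _
        (trans (cnt-flipped l w) (cong (cnt c l w +_) (≤-antisym
          (subst (λ z → ♯ (In? (tr l) w) ≤ ♯ (In? z w)) (tr-tr l) (inject (tr l))) (inject l))))
        where
        inject : ∀ l → ♯ (In? l w) ≤ ♯ (In? (tr l) w)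
        inject l = ♯-inject (In? l w) (In? (tr l) w) (π w)
          (λ (p , f) → paired p f (moved f)) (λ _ _ → π-injective w)

      -- The unpaired edge `e` lies in `F` and everything else in `F` at `w` comes in pairs. So `F`
      -- has one more edge of the majority colour than of the other, exactly the difference between
      -- the full classes, and the two counts trade places.
      exchanged : ∀ {w} → S w → ∀ {e} → F (w , e) → π w e ≡ e →
                  ∀ l → cnt c′ l w ≡ cnt c (tr l) w
      exchanged {w} Sw {e₀} f₀ fix₀ l with Pairing.kind (pairing w) Sw
      ... | even moved _ = contradiction fix₀ (moved (F⊆D f₀))
      ... | odd {e} d fix unique excess _ = counts (KJ? l)
        where
        a = c w e
        kj = proj₂ d
        e∈F : F (w , e)
        e∈F = subst (λ z → F (w , z)) (unique (F⊆D f₀) fix₀) f₀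
        e∈a : Class c a w e × F (w , e)
        e∈a = (proj₁ d , refl) , e∈F
        z = ♯ (In? (tr a) w)
        in-a : ♯ (In? a w) ≡ suc z
        in-a = trans (♯-delete (In? a w) e∈a) (cong suc (≤-antisym
          (♯-inject (delete (In? a w) e) (In? (tr a) w) (π w)
            (λ ((p , f) , ne) → paired p f (ne ∘ unique (F⊆D f))) (λ _ _ → π-injective w))
          (♯-inject (In? (tr a) w) (delete (In? a w) e) (π w)
            (λ {u} (p , f) → back p f) (λ _ _ → π-injective w))))
          where
          back : ∀ {u} → Class c (tr a) w u → F (w , u) →
                 (Class c a w (π w u) × F (w , π w u)) × π w u ≢ e
          back {u} p f = subst (λ l → Class c l w (π w u) × F (w , π w u)) (tr-tr a)
              (paired p f (λ g → u≢e (unique (F⊆D f) g))) ,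
            λ g → u≢e (trans (sym (ππ w u)) (trans (cong (π w) g) fix))
            where
            u≢e : u ≢ e
            u≢e refl = tr-moves kj (proj₂ p)
        count-a : cnt c′ a w ≡ cnt c (tr a) w
        count-a = suc-injective (+-cancelʳ-≡ z _ _ (begin
          suc (cnt c′ a w) + z     ≡⟨ sym (+-suc _ z) ⟩
          cnt c′ a w + suc z       ≡⟨ cong (cnt c′ a w +_) (sym in-a) ⟩
          cnt c′ a w + ♯ (In? a w) ≡⟨ cnt-flipped a w ⟩
          cnt c a w + z            ≡⟨ cong (_+ z) excess ⟩
          suc (cnt c (tr a) w) + z ∎))
          where open ≡-Reasoning
        count-tr-a : cnt c′ (tr a) w ≡ cnt c (tr (tr a)) w
        count-tr-a = +-cancelʳ-≡ z _ _ (begin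
          cnt c′ (tr a) w + z          ≡⟨ cnt-flipped (tr a) w ⟩
          cnt c (tr a) w + ♯ (In? (tr (tr a)) w)
            ≡⟨ cong (λ l → cnt c (tr a) w + ♯ (In? l w)) (tr-tr a) ⟩
          cnt c (tr a) w + ♯ (In? a w) ≡⟨ cong (cnt c (tr a) w +_) in-a ⟩
          cnt c (tr a) w + suc z       ≡⟨ +-suc _ z ⟩
          suc (cnt c (tr a) w) + z     ≡⟨ cong (_+ z) (sym excess) ⟩
          cnt c a w + z                ≡⟨ cong (λ l → cnt c l w + z) (sym (tr-tr a)) ⟩
          cnt c (tr (tr a)) w + z      ∎)
          where open ≡-Reasoning
        none : ¬ KJ l → ∀ u → ¬ (Class c l w u × F (w , u))
        none ¬kj u ((_ , refl) , f) = ¬kj (proj₂ (F⊆D f))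
        counts : Dec (KJ l) → cnt c′ l w ≡ cnt c (tr l) w
        counts (yes kjl) with KJ-cases kjl kj
        ... | inj₁ refl = count-a
        ... | inj₂ refl = count-tr-a
        counts (no ¬kj) = +-cancelʳ-≡ (♯ (In? l w)) _ _ (trans (cnt-flipped l w)
          (cong₂ (λ l₁ l₂ → cnt c l₁ w + ♯ (In? l₂ w)) (sym (tr-fixes ¬kj)) (tr-fixes ¬kj)))

      Effect : Fin n → Set
      Effect w = (∀ l → cnt c′ l w ≡ cnt c l w) × (∀ {u} → F (w , u) → π w u ≢ u) ⊎
                 (∀ l → cnt c′ l w ≡ cnt c (tr l) w) × (∃ λ e → F (w , e) × π w e ≡ e)

      effect : ∀ {w} → S w → Effect w
      effect {w} Sw with any? (λ e → F? (w , e) ×-dec (π w e ≟ e))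
      ... | yes (e , f , fix) = inj₂ (exchanged Sw f fix , e , f , fix)
      ... | no ¬end = inj₁ (unchanged moved , moved)
        where
        moved : ∀ {u} → F (w , u) → π w u ≢ u
        moved f fix = ¬end (_ , f , fix)

      -- Balance is invariant under permuting the colours at a vertex, so it survives either effect.
      flipped : State S
      flipped = record { colour = c′ ; colour-sym = c′-sym ; balanced = balanced′ }
        where
        balanced′ : ∀ {w} → S w → ∀ l l′ → cnt c′ l w ≤ suc (cnt c′ l′ w)
        balanced′ Sw l l′ with effect Sw
        ... | inj₁ (same , _) rewrite same l | same l′ = balanced s Sw l l′
        ... | inj₂ (tran , _) rewrite tran l | tran l′ = balanced s Sw (tr l) (tr l′)

      -- The frequency of the colour of `vu` at `u` could drop only if this is the majority colour
      -- there. But then `vu` is the unpaired edge, so it lies in `F` exactly when the counts at `u`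
      -- are exchanged, and its frequency stays the same.
      level : ∀ {u} → S u → Adj v u → cnt c (leaf s u) u ≤ cnt c′ (c′ v u) u
      level {u} Su a rewrite c′-sym v u | colour-sym s v u = go (F? (u , v)) (effect Su)
        where
        f = c u v
        minor : ∀ {e} → D (u , e) → cnt c (c u e) u ≡ suc (cnt c (tr (c u e)) u) → f ≢ c u e →
                cnt c f u ≤ cnt c (tr f) u
        minor {e} d excess f≢ with KJ? f
        ... | no ¬kj = ≤-reflexive (cong (λ l → cnt c l u) (sym (tr-fixes ¬kj)))
        ... | yes kj with KJ-cases kj (proj₂ d)
        ... | inj₁ p = contradiction p f≢
        ... | inj₂ p rewrite p | tr-tr (c u e) = ≤-trans (n≤1+n _) (≤-reflexive (sym excess))

        atEnd : (∀ {e} → D (u , e) → π u e ≡ e → (Adj u v → c u v ≡ c u e → v ≡ e) → f ≡ c u e → ⊥) →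
          cnt c f u ≤ cnt c (tr f) u
        atEnd no-end with Pairing.kind (pairing u) Su
        ... | even _ same = ≤-reflexive (sym (same f))
        ... | odd d fix _ excess prefer = minor d excess (no-end d fix prefer)

        go : Dec (F (u , v)) → Effect u → cnt c f u ≤ cnt c′ (c′ u v) u
        go (yes p) (inj₂ (tran , _)) rewrite c′-in p =
          ≤-reflexive (sym (trans (tran (tr f)) (cong (λ l → cnt c l u) (tr-tr f))))
        go (yes p) (inj₁ (same , moved)) rewrite c′-in p | same (tr f) =
          atEnd (λ d fix prefer e → moved p (subst (λ z → π u z ≡ z)
            (sym (prefer (Adj-sym a) e)) fix))
        go (no ¬p) (inj₁ (same , _)) rewrite c′-out ¬p = ≤-reflexive (sym (same f))
        go (no ¬p) (inj₂ (tran , e₀ , f₀ , fix₀)) rewrite c′-out ¬p | tran f =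
          atEnd no-end
          where
          no-end : ∀ {e} → D (u , e) → π u e ≡ e → (Adj u v → c u v ≡ c u e → v ≡ e) → f ≡ c u e → ⊥
          no-end {e} d fix prefer q with Pairing.kind (pairing u) Su
          ... | even moved _ = moved d fix
          ... | odd _ _ unique _ _ = ¬p (subst (λ z → F (u , z))
            (trans (unique (F⊆D f₀) fix₀) (trans (sym (unique d fix)) (sym (prefer (Adj-sym a) q)))) f₀)

      -- The frequencies at `u` are only permuted, so their minimum is the same before and after; by
      -- `level` the old frequency is at most the new one, which is that minimum.
      low-preserved : ∀ {u} → LowAt flipped u → LowAt s u
      low-preserved {u} (Su , a , min) = Su , a , go (effect Su)
        where
        go : Effect u → ∀ l → cnt c (leaf s u) u ≤ cnt c l u
        go (inj₁ (same , _)) l = ≤-trans (level Su a) (≤-trans (min l) (≤-reflexive (same l)))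
        go (inj₂ (tran , _)) l = ≤-trans (level Su a) (≤-trans (min (tr l))
          (≤-reflexive (trans (tran (tr l)) (cong (λ l → cnt c l u) (tr-tr l)))))

      low-≤ : low flipped ≤ low s
      low-≤ = ♯-mono (LowAt? flipped) (LowAt? s) low-preserved

-- Moving one edge between colour classes.

record Moved {m} (g g′ : Fin m → ℕ) (a b : Fin m) : Set where
  constructor moved
  field
    -- The additive form covers `a ≡ b`, avoids truncated subtraction and lets moves compose by
    -- transitivity.
    at : ∀ l → g′ l + 𝟙 (a ≟ l) ≡ g l + 𝟙 (b ≟ l)
open Moved

module _ {m} {g g′ : Fin m → ℕ} {a b : Fin m} (mv : Moved g g′ a b) where

  moved-from : a ≢ b → suc (g′ a) ≡ g a
  moved-from a≢b = begin
    suc (g′ a)        ≡⟨ +-comm 1 (g′ a) ⟩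
    g′ a + 1          ≡⟨ cong (g′ a +_) (sym (𝟙-yes (a ≟ a) refl)) ⟩
    g′ a + 𝟙 (a ≟ a)  ≡⟨ at mv a ⟩
    g a + 𝟙 (b ≟ a)   ≡⟨ cong (g a +_) (𝟙-no (b ≟ a) (a≢b ∘ sym)) ⟩
    g a + 0           ≡⟨ +-identityʳ (g a) ⟩
    g a               ∎
    where open ≡-Reasoning

  moved-to : a ≢ b → g′ b ≡ suc (g b)
  moved-to a≢b = begin
    g′ b              ≡⟨ sym (+-identityʳ (g′ b)) ⟩
    g′ b + 0          ≡⟨ cong (g′ b +_) (sym (𝟙-no (a ≟ b) a≢b)) ⟩
    g′ b + 𝟙 (a ≟ b)  ≡⟨ at mv b ⟩
    g b + 𝟙 (b ≟ b)   ≡⟨ cong (g b +_) (𝟙-yes (b ≟ b) refl) ⟩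
    g b + 1           ≡⟨ +-comm (g b) 1 ⟩
    suc (g b)         ∎
    where open ≡-Reasoning

  moved-other : ∀ {l} → l ≢ a → l ≢ b → g′ l ≡ g l
  moved-other {l} l≢a l≢b = begin
    g′ l              ≡⟨ sym (+-identityʳ (g′ l)) ⟩
    g′ l + 0          ≡⟨ cong (g′ l +_) (sym (𝟙-no (a ≟ l) (l≢a ∘ sym))) ⟩
    g′ l + 𝟙 (a ≟ l)  ≡⟨ at mv l ⟩
    g l + 𝟙 (b ≟ l)   ≡⟨ cong (g l +_) (𝟙-no (b ≟ l) (l≢b ∘ sym)) ⟩
    g l + 0           ≡⟨ +-identityʳ (g l) ⟩
    g l               ∎
    where open ≡-Reasoning

  private
    square : ℕ → ℕ
    square z = z * z

    squares : a ≢ b → sum (square ∘ g′) + (square (g a) + square (g b)) ≡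
                      sum (square ∘ g) + (square (g′ a) + square (g′ b))
    squares a≢b = sum-replace₂ a≢b (λ l p q → cong square (moved-other p q))

    same-sum : a ≢ b → g′ a + g′ b ≡ g a + g b
    same-sum a≢b = trans (cong (g′ a +_) (moved-to a≢b)) (trans (+-suc (g′ a) (g b))
      (cong (_+ g b) (moved-from a≢b)))

    a≢b-of : suc (g b) ≤ g a → a ≢ b
    a≢b-of le refl = <-irrefl refl le

  moved-squares-≤ : suc (g b) ≤ g a → sum (λ l → g′ l * g′ l) ≤ sum (λ l → g l * g l)
  moved-squares-≤ le = +-cancelʳ-≤ (square (g a) + square (g b)) _ _
    (≤-trans (≤-reflexive (squares a≢b)) (+-monoʳ-≤ (sum (square ∘ g))
      (squares-≤ {g a} {g b} (same-sum a≢b)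
        (s≤s⁻¹ (subst (suc (g b) ≤_) (sym (moved-from a≢b)) le))
        (subst (g b ≤_) (sym (moved-to a≢b)) (n≤1+n _)))))
    where
    a≢b = a≢b-of le

  -- A gap of one would merely make the two counts trade values; from a gap of two on, both new
  -- values lie strictly above `g b`.
  moved-squares-< : suc (suc (g b)) ≤ g a → sum (λ l → g′ l * g′ l) < sum (λ l → g l * g l)
  moved-squares-< le = +-cancelʳ-< (square (g a) + square (g b)) _ _
    (≤-<-trans (≤-reflexive (squares a≢b)) (+-monoʳ-< (sum (square ∘ g))
      (squares-< {g a} {g b} (same-sum a≢b)
        (s≤s⁻¹ (subst (suc (suc (g b)) ≤_) (sym (moved-from a≢b)) le))
        (subst (g b <_) (sym (moved-to a≢b)) ≤-refl))))
    where
    a≢b = a≢b-of (<⇒≤ le)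

search : ∀ {m a b} {A : Set a} {B : Fin m → Set b} → (∀ i → A ⊎ B i) → A ⊎ (∀ i → B i)
search {zero} f = inj₂ λ ()
search {suc m} f with f zero | search (f ∘ suc)
... | inj₁ a | _ = inj₁ a
... | inj₂ _ | inj₁ a = inj₁ a
... | inj₂ b | inj₂ bs = inj₂ λ { zero → b ; (suc i) → bs i }

-- Fans at `v`.

module Improve {n : ℕ} (G : Graph n) {x : ℕ} (S : Fin n → Set) (S? : Decidable S)
  (v : Fin n) (v∉S : ¬ S v)
  (uneven : ∀ {w} → S w → (s : Counts.State G {x} S) → ∀ l →
            ∃ λ l′ → Counts.cnt G (Counts.State.colour s) l′ w ≢ Counts.cnt G (Counts.State.colour s) l w)
  where

  open Recolour G {x} S S? v v∉S

  N : State S → Fin x → ℕ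
  N s l = count s l v

  -- `N s` is `leafCount (leaf s)`. Allowing an arbitrary assignment of colours to leaves gives room
  -- for intermediate stages that need not come from a state.
  leafCount : (Fin n → Fin x) → Fin x → ℕ
  leafCount f l = ♯ (λ u → Adj? v u ×-dec (f u ≟ l))

  leafCount-moved : ∀ {f f′ : Fin n → Fin x} {u a b} → Adj v u → f u ≡ a → f′ u ≡ b →
                    (∀ {y} → y ≢ u → f′ y ≡ f y) → Moved (leafCount f) (leafCount f′) a b
  leafCount-moved {f} {f′} {u} {a} {b} adj p q same = moved λ l → begin
    leafCount f′ l + 𝟙 (a ≟ l)
      ≡⟨ cong (leafCount f′ l +_) (𝟙-cong (a ≟ l) (Adj? v u ×-dec (f u ≟ l))
           (λ e → adj , trans p e) (λ (_ , e) → trans (sym p) e)) ⟩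
    leafCount f′ l + 𝟙 (Adj? v u ×-dec (f u ≟ l))
      ≡⟨ sum-replace u (λ y y≢u → 𝟙-cong (Adj? v y ×-dec (f′ y ≟ l)) (Adj? v y ×-dec (f y ≟ l))
           (λ (d , e) → d , trans (sym (same y≢u)) e) (λ (d , e) → d , trans (same y≢u) e)) ⟩
    leafCount f l + 𝟙 (Adj? v u ×-dec (f′ u ≟ l))
      ≡⟨ cong (leafCount f l +_) (𝟙-cong (Adj? v u ×-dec (f′ u ≟ l)) (b ≟ l)
           (λ (_ , e) → trans (sym q) e) (λ e → adj , trans q e)) ⟩
    leafCount f l + 𝟙 (b ≟ l) ∎
    where open ≡-Reasoning

  Move : State S → State S → Fin x → Fin x → Set
  Move s s′ = Moved (N s) (N s′)

  Q : State S → ℕ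
  Q s = sum (λ l → N s l * N s l)

  LowDec : State S → Set
  LowDec s = ∃ λ s′ → low s′ < low s

  -- Lexicographic descent: a drop of `low` may be paid for by any growth of `Q`.
  Improved : State S → Set
  Improved s = ∃ λ s′ → low s′ < low s ⊎ low s′ ≤ low s × Q s′ < Q s

  improved-low : ∀ {s} → LowDec s → Improved s
  improved-low (s′ , lt) = s′ , inj₁ lt

  lowDec-from : ∀ {s s₁} → low s₁ ≤ low s → LowDec s₁ → LowDec s
  lowDec-from le (s′ , lt) = s′ , <-≤-trans lt le

  improved-from : ∀ {s s₁} → low s₁ ≤ low s → Q s₁ ≤ Q s → Improved s₁ → Improved s
  improved-from le _ (s′ , inj₁ lt) = s′ , inj₁ (<-≤-trans lt le)
  improved-from le le′ (s′ , inj₂ (p , q)) = s′ , inj₂ (≤-trans p le , <-≤-trans q le′)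

  -- The frequency condition makes `shift` work: if its trail only passes through `u`, the frequency
  -- of the colour of `vu` rises strictly there, and `low` drops.
  Arc : State S → Fin n → Fin x → Set
  Arc s u g = Adj v u × leaf s u ≢ g × (S u → count s g u ≢ count s (leaf s u) u)

  record Shifted (s : State S) (u : Fin n) (g : Fin x) : Set where
    field
      state : State S
      low≤ : low state ≤ low s
      recoloured : leaf state u ≡ g
      leaves : ∀ {y} → y ≢ u → leaf state y ≡ leaf s y
      counts : ∀ {w} → S w → w ≢ u → ∀ l → count state l w ≡ count s l w

  -- The trail from the leaf vu in the colours of vu and g either stops at u, or else makes
  -- the colour of vu a majority colour at u.
  shift : ∀ s {u g} → Arc s u g → Shifted s u g ⊎ LowDec s
  shift s {u} {g} (adj , f≢g , ne) = go (w ≟ u)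
    where
    f = leaf s u
    open Flip s f≢g
    t = trail {v} {u} (adj , inj₁ refl) (π-free v∉S u)
    open Trail t
    w = proj₁ end
    C = closed t
    open Flipped C
    u≢v : u ≢ v
    u≢v = Adj-irrefl (Adj-sym adj)
    ends : ∀ {w′ y} → F (w′ , y) → π w′ y ≡ y → w′ ≢ v → w′ ≡ w
    ends {w′} p e w′≢v with only-ends p (cong (w′ ,_) e)
    ... | inj₁ q = contradiction (cong proj₁ q) w′≢v
    ... | inj₂ q = cong proj₁ q
    leaf-u : leaf flipped u ≡ g
    leaf-u = trans (c′-in start) (transpose-matchˡ f g)
    go : Dec (w ≡ u) → Shifted s u g ⊎ LowDec s
    go (yes w≡u) = inj₁ record
      { state = flipped
      ; low≤ = low-≤
      ; recoloured = leaf-u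
      ; leaves = λ y≢u → c′-out (λ p → other y≢u p)
      ; counts = λ Sw w′≢u → unchanged (λ p e → w′≢u (trans (ends p e (λ { refl → v∉S Sw })) w≡u))
      }
      where
      other : ∀ {y} → y ≢ u → ¬ F (v , y)
      other y≢u p with only-ends p (cong (v ,_) (π-free v∉S _))
      ... | inj₁ q = y≢u (cong proj₂ q)
      ... | inj₂ q = u≢v (trans (sym w≡u) (sym (cong proj₁ q)))
    go (no w≢u) with S? u
    -- With nothing paired at `u`, the trail would have stopped there after its first edge.
    ... | no ¬Su = contradiction (sym (ends (closed-τ start) (π-free ¬Su v) u≢v)) w≢u
    ... | yes Su = inj₂ (flipped , ♯-mono-< (LowAt? flipped) (LowAt? s) low-preserved {u} lowBefore notLow)
      where
      same : ∀ l → count flipped l u ≡ count s l u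
      same = unchanged (λ p e → w≢u (sym (ends p e u≢v)))
      level-u : count s f u ≤ count s g u
      level-u = subst (count s f u ≤_) (trans (cong (λ l → count flipped l u) leaf-u) (same g)) (level Su adj)
      -- By balance `count s g u` exceeds no other frequency by more than one, so lying strictly
      -- below it means being minimal.
      f<g : count s f u < count s g u
      f<g = ≤∧≢⇒< level-u (ne Su ∘ sym)
      lowBefore : LowAt s u
      lowBefore = Su , adj , λ l → s≤s⁻¹ (≤-trans f<g (balanced s Su g l))
      notLow : ¬ LowAt flipped u
      notLow (_ , _ , min) = <⇒≱ f<g (subst₂ _≤_
        (trans (cong (λ l → count flipped l u) leaf-u) (same g)) (same f) (min f))

  -- A Vizing fan listed from its tip: the head takes `g`, every later leaf takes the colour given
  -- up by its predecessor, and the last one gives up `a`. Freshness makes the leaf colours, hence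
  -- the leaves, distinct.
  data Chain (s : State S) (a : Fin x) : List (Fin n) → Fin x → Set where
    [] : Chain s a [] a
    step : ∀ {u us g} → Arc s u g → (∀ {y} → y ∈ u ∷ us → leaf s y ≢ g) →
           Chain s a us (leaf s u) → Chain s a (u ∷ us) g

  fresh : ∀ {s a us g} → Chain s a us g → ∀ {y} → y ∈ us → leaf s y ≢ g
  fresh (step _ fr _) = fr

  source : ∀ {s a u us g} → Chain s a (u ∷ us) g → ∃ λ y → y ∈ u ∷ us × leaf s y ≡ a
  source (step _ _ []) = _ , here refl , refl
  source (step _ _ ch@(step _ _ _)) with source ch
  ... | y , p , e = y , there p , e

  -- `R` and `a ≢ h` narrow down the arcs to be carried over. After an exchange of `k` and `j` in a
  -- fan starting at `k`, this leaves only arcs to colours whose frequencies the exchange does not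
  -- affect.
  transfer : ∀ (R : Fin x → Set) {s s′ a us g} →
             (∀ {y} → y ∈ us → leaf s′ y ≡ leaf s y) →
             (∀ {y h} → y ∈ us → R h → a ≢ h → Arc s y h → Arc s′ y h) →
             R g → (∀ {y} → y ∈ us → R (leaf s y)) →
             Chain s a us g → Chain s′ a us g
  transfer R same arcs Rg Rus [] = []
  transfer R {s} {s′} {a} {u ∷ us} {g} same arcs Rg Rus ch₀@(step arc fr ch) =
    step (arcs (here refl) Rg a≢g arc) (λ p e → fr p (trans (sym (same p)) e))
      (subst (Chain s′ a us) (sym (same (here refl)))
        (transfer R (same ∘ there) (arcs ∘ there) (Rus (here refl)) (Rus ∘ there) ch))
    where
    a≢g : a ≢ g
    a≢g e with source ch₀
    ... | y , p , q = fr p (trans q e)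

  arc-agrees : ∀ {s s′ y h} → leaf s′ y ≡ leaf s y → (S y → ∀ l → count s′ l y ≡ count s l y) →
               Arc s y h → Arc s′ y h
  arc-agrees {s} {s′} {y} {h} same counts (adj , ne , diff) =
    adj , (λ e → ne (trans (sym same) e)) , λ Sy e → diff Sy (begin
      count s h y            ≡⟨ sym (counts Sy h) ⟩
      count s′ h y           ≡⟨ e ⟩
      count s′ (leaf s′ y) y ≡⟨ counts Sy (leaf s′ y) ⟩
      count s (leaf s′ y) y  ≡⟨ cong (λ l → count s l y) same ⟩
      count s (leaf s y) y   ∎)
    where open ≡-Reasoning

  record ShiftedAlong (s : State S) (a : Fin x) (us : List (Fin n)) (g : Fin x) : Set where
    field
      state : State S
      low≤ : low state ≤ low s
      leaves : ∀ {y} → y ∉ us → leaf state y ≡ leaf s y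
      counts : ∀ {w} → S w → w ∉ us → ∀ l → count state l w ≡ count s l w
      move : Move s state a g

  -- The tip is shifted first. This changes nothing at the other leaves, so the rest remains a fan,
  -- and the moves between classes telescope to a single one.
  shiftAlong : ∀ us {s a g} → Chain s a us g → ShiftedAlong s a us g ⊎ LowDec s
  shiftAlong [] {s} [] = inj₁ record
    { state = s ; low≤ = ≤-refl ; leaves = λ _ → refl ; counts = λ _ _ _ → refl ; move = moved (λ _ → refl) }
  shiftAlong (u ∷ us) {s} {a} {g} (step arc fr ch) with shift s arc
  ... | inj₂ dec = inj₂ dec
  ... | inj₁ sh = go (shiftAlong us (transfer (λ _ → ⊤) (λ p → X.leaves (rest p))
          (λ p _ _ → arc-agrees {s} {X.state} (X.leaves (rest p)) (λ Sy → X.counts Sy (rest p)))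
          tt (λ _ → tt) ch))
    where
    module X = Shifted sh
    rest : ∀ {y} → y ∈ us → y ≢ u
    rest p refl = fresh ch p refl
    go : ShiftedAlong X.state a us (leaf s u) ⊎ LowDec X.state → ShiftedAlong s a (u ∷ us) g ⊎ LowDec s
    go (inj₂ dec) = inj₂ (lowDec-from {s} {X.state} X.low≤ dec)
    go (inj₁ sh′) = inj₁ record
      { state = Y.state
      ; low≤ = ≤-trans Y.low≤ X.low≤
      ; leaves = λ p → trans (Y.leaves (p ∘ there)) (X.leaves (p ∘ here))
      ; counts = λ Sw p l → trans (Y.counts Sw (p ∘ there) l) (X.counts Sw (p ∘ here) l)
      ; move = moved (λ l → trans (at Y.move l) (at (leafCount-moved {leaf s} {leaf X.state} {u}
                      (proj₁ arc) refl X.recoloured X.leaves) l))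
      }
      where module Y = ShiftedAlong sh′

  improve-along : ∀ {s us a g} → Chain s a us g → suc (suc (N s g)) ≤ N s a → Improved s
  improve-along {s} {us} ch le with shiftAlong us ch
  ... | inj₂ dec = improved-low {s} dec
  ... | inj₁ sh = X.state , inj₂ (X.low≤ , moved-squares-< X.move le)
    where module X = ShiftedAlong sh

  -- The cut is just behind `z`: `as` is the part from the tip through `z`, and `bs` is what
  -- follows. As the two parts share no colour, recolouring along one leaves the other intact.
  split : ∀ {s a us g} → Chain s a us g → ∀ {z} → z ∈ us →
          ∃₂ λ as bs → Chain s a bs (leaf s z) × Chain s (leaf s z) as g ×
            (∀ {y} → y ∈ as → y ∈ us) × (∀ {y} → y ∈ bs → y ∈ us) ×
            (∀ {y y′} → y ∈ as → y′ ∈ bs → leaf s y ≢ leaf s y′)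
  split {s} (step {u} {us} arc fr ch) (here refl) =
    u ∷ [] , us , ch , step arc (λ { (here refl) → fr (here refl) }) [] ,
    (λ { (here e) → here e }) , there , λ { (here refl) q e → fresh ch q (sym e) }
  split {s} (step {u} {us} arc fr ch) (there p) with split ch p
  ... | as , bs , chb , cha , as⊆ , bs⊆ , apart =
    u ∷ as , bs , chb ,
    step arc (λ { (here e) → fr (here e) ; (there q) → fr (there (as⊆ q)) }) cha ,
    (λ { (here e) → here e ; (there q) → there (as⊆ q) }) , there ∘ bs⊆ ,
    λ { (here refl) q e → fresh ch (bs⊆ q) (sym e) ; (there q) q′ → apart q q′ }

  -- Kempe exchanges when a fan closes up.

  module Kempe (s : State S) {k j : Fin x} (k≢j : k ≢ j)
    (excess : suc (suc (N s j)) ≤ N s k) where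

    open Flip s k≢j
    open Trail using (end; only-ends; start; end∈F; end-fixed; end≢start)

    private
      f = leaf s

      Half : Fin n × Fin n → Set₁
      Half = Trail swap Π D

    -- The exchange recolours a single edge at `v`, from `k` to `j`, and `excess` makes `Q` drop.
    leafEnd : ∀ {F} (C : Closed F) {y} → F (v , y) → f y ≡ k →
              (∀ {y′} → F (v , y′) → y′ ≡ y) → Improved s
    leafEnd C {y} p fy≡k only = flipped , inj₂ (low-≤ , moved-squares-<
      (leafCount-moved {leaf s} {leaf flipped} {y} (proj₁ (Closed.F⊆D C p)) fy≡k
        (trans (c′-in p) (trans (cong tr fy≡k) (transpose-matchˡ k j)))
        (λ ne → c′-out (ne ∘ only))) excess)
      where open Flipped C

    leafFixed : ∀ y → Π (v , y) ≡ (v , y)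
    leafFixed y = cong (v ,_) (π-free v∉S y)

    JEnd : Fin n → Fin n → Set₁
    JEnd y z = Class (colour s) j v z × Σ (Half (v , y)) λ T → end T ≡ (v , z)

    -- Two edges at v pass from k to j and one passes back, hence a net move of one.
    doubleFlip : ∀ {u e z} → u ≢ v → (T : Half (u , e)) → end T ≡ (v , z) → f z ≡ j →
                 ∀ {y y₁} → f y ≡ k → (T₁ : Half (v , y)) → end T₁ ≡ (v , y₁) → f y₁ ≡ k → Improved s
    doubleFlip {u} {e} {z} u≢v T Te fz {y} {y₁} fy T₁ T₁e fy₁ =
      flipped , inj₂ (low-≤ , moved-squares-< total excess)
      where
      C = union (closed T) (closed T₁)
      open Flipped C
      z∈ : Trail.F T (v , z)
      z∈ = subst (Trail.F T) Te (end∈F T)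
      y₁∈ : Trail.F T₁ (v , y₁)
      y₁∈ = subst (Trail.F T₁) T₁e (end∈F T₁)
      y₁≢y : y₁ ≢ y
      y₁≢y refl = end≢start T₁ T₁e
      outside : ∀ {y′} → y′ ≢ y → y′ ≢ y₁ → y′ ≢ z → ¬ (Trail.F T (v , y′) ⊎ Trail.F T₁ (v , y′))
      outside p q r (inj₁ m) with only-ends T m (leafFixed _)
      ... | inj₁ eq = u≢v (sym (cong proj₁ eq))
      ... | inj₂ eq = r (cong proj₂ (trans eq Te))
      outside p q r (inj₂ m) with only-ends T₁ m (leafFixed _)
      ... | inj₁ eq = p (cong proj₂ eq)
      ... | inj₂ eq = q (cong proj₂ (trans eq T₁e))
      tr-k : ∀ {l} → l ≡ k → tr l ≡ j
      tr-k refl = transpose-matchˡ k j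
      -- Intermediate stages: `y` and `y₁` turn to `j` one after the other, and passing to
      -- `leaf flipped` then turns `z` back to `k`.
      f₁ = updateAt f y (const j)
      f₂ = updateAt f₁ y₁ (const j)
      f₁-other : ∀ {y′} → y′ ≢ y → f₁ y′ ≡ f y′
      f₁-other ne = updateAt-minimal _ y f ne
      f₂-other : ∀ {y′} → y′ ≢ y₁ → f₂ y′ ≡ f₁ y′
      f₂-other ne = updateAt-minimal _ y₁ f₁ ne
      f₂-y : f₂ y ≡ j
      f₂-y = trans (f₂-other (y₁≢y ∘ sym)) (updateAt-updates y f)
      f₂-z : f₂ z ≡ j
      f₂-z with z ≟ y₁
      ... | yes refl = updateAt-updates y₁ f₁
      ... | no z≢y₁ with z ≟ y
      ... | yes refl = f₂-y
      ... | no z≢y = trans (f₂-other z≢y₁) (trans (f₁-other z≢y) fz)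
      agree : ∀ {y′} → y′ ≢ z → leaf flipped y′ ≡ f₂ y′
      agree {y′} ne with y′ ≟ y₁
      ... | yes refl = trans (c′-in (inj₂ y₁∈)) (trans (tr-k fy₁) (sym (updateAt-updates y₁ f₁)))
      ... | no p with y′ ≟ y
      ... | yes refl = trans (c′-in (inj₂ (start T₁))) (trans (tr-k fy) (sym f₂-y))
      ... | no q = trans (c′-out (outside q p ne)) (sym (trans (f₂-other p) (f₁-other q)))
      total : Move s flipped k j
      total = moved λ l → trans (cong (_+ 𝟙 (k ≟ l)) (+-cancelʳ-≡ (𝟙 (j ≟ l)) _ _
          (trans (at (leafCount-moved {f₂} {leaf flipped} {z} (proj₁ (Trail.F⊆D T z∈)) f₂-z
                   (trans (c′-in (inj₁ z∈)) (trans (cong tr fz) (transpose-matchʳ k j))) agree) l)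
                 (at (leafCount-moved {f₁} {f₂} {y₁} (proj₁ (Trail.F⊆D T₁ y₁∈)) (trans (f₁-other y₁≢y) fy₁)
                   (updateAt-updates y₁ f₁) f₂-other) l))))
        (at (leafCount-moved {f} {f₁} {y} (proj₁ (Trail.F⊆D T₁ (start T₁))) fy (updateAt-updates y f) f₁-other) l)

    -- If the trail from the `k`-leaf `y` ends away from `v`, exchanging on it alone improves; if it
    -- ends at another `k`-leaf, exchanging on it together with `T` does. Only an end at a `j`-leaf
    -- remains.
    fromKLeaf : ∀ {u e z} → u ≢ v → (T : Half (u , e)) → end T ≡ (v , z) → f z ≡ j →
                ∀ {y} → Class (colour s) k v y → Improved s ⊎ ∃ (JEnd y)
    fromKLeaf u≢v T Te fz {y} (adj , fy) = go (end T₁) refl (proj₁ (end T₁) ≟ v)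
      where
      T₁ = trail {v} {y} (adj , inj₁ fy) (π-free v∉S y)
      go : ∀ h → end T₁ ≡ h → Dec (proj₁ h ≡ v) → Improved s ⊎ ∃ (JEnd y)
      go (w , y₁) T₁e (no w≢v) = inj₁ (leafEnd (closed T₁) (start T₁) fy only)
        where
        only : ∀ {y′} → Trail.F T₁ (v , y′) → y′ ≡ y
        only p with only-ends T₁ p (leafFixed _)
        ... | inj₁ eq = cong proj₂ eq
        ... | inj₂ eq = contradiction (sym (cong proj₁ (trans eq T₁e))) w≢v
      go (w , y₁) T₁e (yes refl) with Trail.F⊆D T₁ (subst (Trail.F T₁) T₁e (end∈F T₁))
      ... | adj₁ , inj₁ fy₁ = inj₁ (doubleFlip u≢v T Te fz fy T₁ T₁e fy₁)
      ... | adj₁ , inj₂ fy₁ = inj₂ (y₁ , (adj₁ , fy₁) , T₁ , T₁e)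

    -- Pigeonhole: were all trails from `k`-leaves to end at `j`-leaves, `end-injective` would
    -- inject the `k`-leaves into the fewer `j`-leaves.
    toJLeaf : ∀ {u e z} → u ≢ v → (T : Half (u , e)) → end T ≡ (v , z) → f z ≡ j → Improved s
    toJLeaf u≢v T Te fz with search each
      where
      each : ∀ y → Improved s ⊎ (∃ λ z → Class (colour s) k v y → JEnd y z)
      each y with Class? (colour s) k v y
      ... | no ¬p = inj₂ (y , λ p → contradiction p ¬p)
      ... | yes p = map₂ (λ (z , q) → z , λ _ → q) (fromKLeaf u≢v T Te fz p)
    ... | inj₁ improved = improved
    ... | inj₂ ends = contradiction (♯-inject (Class? (colour s) k v) (Class? (colour s) j v)
      (proj₁ ∘ ends) (λ {y} p → proj₁ (proj₂ (ends y) p)) injective) (<⇒≱ (<⇒≤ excess))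
      where
      injective : ∀ {y y′} → Class (colour s) k v y → Class (colour s) k v y′ →
                  proj₁ (ends y) ≡ proj₁ (ends y′) → y ≡ y′
      injective {y} {y′} p p′ e = cong proj₂ (end-injective swap-swap ΠΠ
        (proj₁ p′ , inj₁ (proj₂ p′)) (leafFixed y′) T₁ T₂ (trans T₁e (trans (cong (v ,_) e) (sym T₂e))))
        where
        T₁ = proj₁ (proj₂ (proj₂ (ends y) p))
        T₁e = proj₂ (proj₂ (proj₂ (ends y) p))
        T₂ = proj₁ (proj₂ (proj₂ (ends y′) p′))
        T₂e = proj₂ (proj₂ (proj₂ (ends y′) p′))

    -- At `u` the colour `j` is as frequent as `f u` while `k` is not, so `k` and `j` differ there
    -- and one edge is unpaired. If its trail ends at `v`, the end is a leaf of colour `k` or `j`,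
    -- and either case improves. Otherwise exchanging on it preserves all leaf colours and makes `j`
    -- differ from `f u` at `u`, so the fan extends from `u` to `j`.
    kempe : ∀ {u as} → Chain s k as (f u) → Adj v u → S u →
            k ≢ f u → f u ≢ j → count s k u ≢ count s (f u) u → count s j u ≡ count s (f u) u →
            (∀ {y} → y ∈ as → f y ≢ j) →
            (∀ {y} → y ∈ as → S y → count s j y ≡ count s (f y) y) → Improved s
    kempe {u} {as} ch adj Su k≢l l≢j k-differs j-same as≢j as-same
      with Pairing.kind (pairing u) Su
    ... | even _ same = contradiction
      (trans (sym (same k)) (trans (cong (λ l → count s l u) (transpose-matchˡ k j)) j-same)) k-differs
    ... | odd {e} d fix _ _ _ = go (end T) refl (proj₁ (end T) ≟ v)
      where
      T = trail d fix
      C = closed T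
      u≢v : u ≢ v
      u≢v = Adj-irrefl (Adj-sym adj)
      go : ∀ h → end T ≡ h → Dec (proj₁ h ≡ v) → Improved s
      go (w , z) Te (yes refl) with Trail.F⊆D T (subst (Trail.F T) Te (end∈F T))
      ... | _ , inj₂ fz = toJLeaf u≢v T Te fz
      ... | _ , inj₁ fz = leafEnd C (subst (Trail.F T) Te (end∈F T)) fz only
        where
        only : ∀ {y′} → Trail.F T (v , y′) → y′ ≡ z
        only p with only-ends T p (leafFixed _)
        ... | inj₁ eq = contradiction (sym (cong proj₁ eq)) u≢v
        ... | inj₂ eq = cong proj₂ (trans eq Te)
      go (w , z) Te (no w≢v) = improved-from {s} {flipped} low-≤ (≤-reflexive Q-same)
        (improve-along {flipped} {u ∷ as} {k} {j}
          (step (adj , (λ q → l≢j (trans (sym (leaves u)) q)) , λ _ → arc)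
            (λ { (here refl) q → l≢j (trans (sym (leaves u)) q)
               ; (there p) q → as≢j p (trans (sym (leaves _)) q) })
            (subst (Chain flipped k as) (sym (leaves u))
              (transfer (_≢ j) {s} {flipped} (λ _ → leaves _) transferArc l≢j as≢j ch)))
          (subst₂ (λ p q → suc (suc p) ≤ q) (sym (N-same j)) (sym (N-same k)) excess))
        where
        open Flipped C
        leaves : ∀ y → leaf flipped y ≡ f y
        leaves y = c′-out none
          where
          none : ¬ Trail.F T (v , y)
          none p with only-ends T p (leafFixed y)
          ... | inj₁ eq = u≢v (sym (cong proj₁ eq))
          ... | inj₂ eq = w≢v (sym (cong proj₁ (trans eq Te)))
        N-same : ∀ l → N flipped l ≡ N s l
        N-same l = ♯-cong (Class? (colour flipped) l v) (Class? (colour s) l v)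
          (λ {y} (a , q) → a , trans (sym (leaves y)) q) (λ {y} (a , q) → a , trans (leaves y) q)
        Q-same : Q flipped ≡ Q s
        Q-same = sum-cong-≗ (λ l → cong (λ q → q * q) (N-same l))
        exch : ∀ l → count flipped l u ≡ count s (tr l) u
        exch = exchanged Su (start T) fix
        arc : count flipped j u ≢ count flipped (leaf flipped u) u
        arc q = k-differs (begin
          count s k u                     ≡⟨ cong (λ l → count s l u) (sym (transpose-matchʳ k j)) ⟩
          count s (tr j) u                ≡⟨ sym (exch j) ⟩
          count flipped j u               ≡⟨ q ⟩
          count flipped (leaf flipped u) u ≡⟨ cong (λ l → count flipped l u) (leaves u) ⟩
          count flipped (f u) u           ≡⟨ exch (f u) ⟩
          count s (tr (f u)) u            ≡⟨ cong (λ l → count s l u) (transpose-mismatch k j (k≢l ∘ sym) l≢j) ⟩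
          count s (f u) u                 ∎)
          where open ≡-Reasoning
        transferArc : ∀ {y h} → y ∈ as → h ≢ j → k ≢ h → Arc s y h → Arc flipped y h
        transferArc {y} {h} y∈ h≢j k≢h (a , ne , diff) = a , (λ q → ne (trans (sym (leaves y)) q)) ,
          λ Sy q → diff Sy (trans (sym (at-h Sy)) (trans q
            (trans (cong (λ l → count flipped l y) (leaves y)) (at-f Sy))))
          where
          at-h : S y → count flipped h y ≡ count s h y
          at-h Sy with effect Sy
          ... | inj₁ (same , _) = same h
          ... | inj₂ (tran , _) = trans (tran h)
            (cong (λ l → count s l y) (transpose-mismatch k j (k≢h ∘ sym) h≢j))
          at-f : S y → count flipped (f y) y ≡ count s (f y) y
          at-f Sy with effect Sy
          ... | inj₁ (same , _) = same (f y)
          ... | inj₂ (tran , _) with f y ≟ k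
          ... | no fy≢k = trans (tran (f y))
            (cong (λ l → count s l y) (transpose-mismatch k j fy≢k (as≢j y∈)))
          -- By `as-same` the colours `k` and `j` are equally frequent at `y`, so exchanging their
          -- counts is harmless.
          ... | yes fy≡k = trans (tran (f y)) (trans
            (cong (λ l → count s l y) (trans (cong tr fy≡k) (transpose-matchˡ k j))) (as-same y∈ Sy))

  open Kempe using (kempe)

  -- The fan returns to the colour `h` of `z`: `bs` is a stick from `i` to `h`, and `as` with `u` is
  -- a loop through `h`. `kempe` applies to the loop with `k = h` once `h` has an excess of two over
  -- `j` at `v`.
  lollipop : ∀ {s i j us u h} → suc (suc (N s j)) ≤ N s i → Chain s i us (leaf s u) →
             N s j < N s (leaf s u) → (∀ {y} → y ∈ us → N s j < N s (leaf s y)) →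
             (∀ {y} → y ∈ us → S y → count s j y ≡ count s (leaf s y) y) →
             Adj v u → S u → count s j u ≡ count s (leaf s u) u →
             N s j < N s h → h ≢ leaf s u → count s h u ≢ count s (leaf s u) u →
             ∀ {z} → z ∈ us → leaf s z ≡ h → Improved s
  lollipop {s} {i} {j} {us} {u} {h} gap ch j<g j<us us-same adj Su u-same j<h h≢g differs z∈ refl
    with split ch z∈
  ... | as , bs , chb , cha , as⊆ , bs⊆ , apart = go (suc (suc (N s j)) ≤? N s h)
    where
    ≢j : ∀ {l} → N s j < N s l → l ≢ j
    ≢j lt refl = <-irrefl refl lt

    finish : ∀ s₁ → low s₁ ≤ low s → Q s₁ ≤ Q s → suc (suc (N s₁ j)) ≤ N s₁ h →
             (∀ {y} → y ∉ bs → leaf s₁ y ≡ leaf s y) →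
             (∀ {w} → S w → w ∉ bs → ∀ l → count s₁ l w ≡ count s l w) → Improved s
    finish s₁ low≤ Q≤ excess leaves counts = improved-from {s} {s₁} low≤ Q≤
      (kempe s₁ (≢j j<h) excess {u} {as}
        (subst (Chain s₁ h as) (sym leaf-u)
          (transfer (λ _ → ⊤) (leaves ∘ as∉)
            (λ p _ _ → arc-agrees {s} {s₁} (leaves (as∉ p)) (λ Sy → counts Sy (as∉ p)))
            tt (λ _ → tt) cha))
        adj Su
        (λ e → h≢g (trans e leaf-u))
        (λ e → ≢j j<g (trans (sym leaf-u) e))
        (λ e → differs (trans (sym (counts Su u∉ h)) (trans e at-u)))
        (trans (counts Su u∉ j) (trans u-same (sym at-u)))
        (λ p e → ≢j (j<us (as⊆ p)) (trans (sym (leaves (as∉ p))) e))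
        (λ {y} p Sy → trans (counts Sy (as∉ p) j) (trans (us-same (as⊆ p) Sy)
          (sym (trans (cong (λ l → count s₁ l y) (leaves (as∉ p))) (counts Sy (as∉ p) (leaf s y)))))))
      where
      as∉ : ∀ {y} → y ∈ as → y ∉ bs
      as∉ p q = apart p q refl
      u∉ : u ∉ bs
      u∉ p = fresh ch (bs⊆ p) refl
      leaf-u : leaf s₁ u ≡ leaf s u
      leaf-u = leaves u∉
      at-u : count s₁ (leaf s₁ u) u ≡ count s (leaf s u) u
      at-u = trans (cong (λ l → count s₁ l u) leaf-u) (counts Su u∉ (leaf s u))

    go : Dec (suc (suc (N s j)) ≤ N s h) → Improved s
    go (yes le) = finish s ≤-refl ≤-refl le (λ _ → refl) (λ _ _ _ → refl)
    -- Now `N s h` is `N s j + 1`. Shifting along the stick supplies the missing edge, and as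
    -- `N s i` exceeds `N s h` the sum of squares does not grow.
    go (no ¬le) with shiftAlong bs chb
    ... | inj₂ dec = improved-low {s} dec
    ... | inj₁ sh = finish X.state X.low≤
      (moved-squares-≤ X.move (≤-trans (s≤s Nh≤) gap))
      (≤-reflexive (begin
        suc (suc (N X.state j)) ≡⟨ cong (λ z → suc (suc z)) (moved-other X.move j≢i (≢j j<h ∘ sym)) ⟩
        suc (suc (N s j))       ≡⟨ cong suc (≤-antisym j<h Nh≤) ⟩
        suc (N s h)             ≡⟨ sym (moved-to X.move i≢h) ⟩
        N X.state h             ∎))
      X.leaves X.counts
      where
      open ≡-Reasoning
      module X = ShiftedAlong sh
      Nh≤ : N s h ≤ suc (N s j)
      Nh≤ = s≤s⁻¹ (≰⇒> ¬le)
      i≢h : i ≢ h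
      i≢h refl = ¬le gap
      j≢i : j ≢ i
      j≢i refl = <⇒≱ gap (n≤1+n _)

  -- Growing a fan, and the descent.

  module Grow (s : State S) {i j : Fin x} (gap : suc (suc (N s j)) ≤ N s i) where

    Unvisited : Fin x → List (Fin n) → Fin x → Set
    Unvisited g us l = l ≢ g × ¬ Any (λ y → leaf s y ≡ l) us

    Unvisited? : ∀ g us → Decidable (Unvisited g us)
    Unvisited? g us l = ¬? (l ≟ g) ×-dec ¬? (Any.any? (λ y → leaf s y ≟ l) us)

    -- Each extension visits a new colour, which bounds the length. The invariants say that the fan
    -- has not reached a colour as rare at `v` as `j`, and that no balanced leaf on it could take
    -- `j`. As `N s g` is positive, a leaf of colour `g` exists.
    grow : ∀ {g us} → Acc _<_ (♯ (Unvisited? g us)) → Chain s i us g →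
           N s j < N s g → (∀ {y} → y ∈ us → N s j < N s (leaf s y)) →
           (∀ {y} → y ∈ us → S y → count s j y ≡ count s (leaf s y) y) → Improved s
    grow {g} {us} (acc rec) ch j<g j<us us-same
      with ♯-inhabited (Class? (colour s) g v) (≤-trans (s≤s z≤n) j<g)
    ... | u , adj , refl = go (S? u)
      where
      toJ : (S u → count s j u ≢ count s (leaf s u) u) → Improved s
      toJ differs = improve-along {s} {u ∷ us} (step
        (adj , (λ e → <-irrefl (cong (N s) (sym e)) j<g) , differs)
        (λ { (here refl) e → <-irrefl (cong (N s) (sym e)) j<g
           ; (there p) e → <-irrefl (cong (N s) (sym e)) (j<us p) }) ch) gap

      go : Dec (S u) → Improved s
      go (no ¬Su) = toJ (λ Su → contradiction Su ¬Su)
      go (yes Su) with count s j u ℕ.≟ count s (leaf s u) u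
      ... | no differs = toJ (λ _ → differs)
      -- Not all colours are equally frequent at `u`, so some colour `h` continues the fan.
      ... | yes same with uneven Su s (leaf s u)
      ... | h , differs = next (N s h ≤? N s j) (Any.any? (λ y → leaf s y ≟ h) us)
        where
        h≢g : h ≢ leaf s u
        h≢g refl = differs refl
        next : Dec (N s h ≤ N s j) → Dec (Any (λ y → leaf s y ≡ h) us) → Improved s
        next (yes h≤j) _ = improve-along {s} {u ∷ us}
          (step (adj , h≢g ∘ sym , λ _ → differs)
            (λ { (here refl) → h≢g ∘ sym ; (there p) e → <⇒≱ (j<us p) (subst (λ l → N s l ≤ N s j) (sym e) h≤j) }) ch)
          (≤-trans (s≤s (s≤s h≤j)) gap)
        next (no h≰j) (yes visited) with find visited
        ... | z , z∈ , e = lollipop {s} gap ch j<g j<us us-same adj Su same (≰⇒> h≰j) h≢g differs z∈ e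
        next (no h≰j) (no unvisited) = grow
          (rec (♯-mono-< (Unvisited? h (u ∷ us)) (Unvisited? (leaf s u) us)
            (λ (_ , q) → (λ e → q (here (sym e))) , q ∘ there)
            {h} (h≢g , unvisited) (λ (q , _) → q refl)))
          (step (adj , h≢g ∘ sym , λ _ → differs)
            (λ { (here refl) → h≢g ∘ sym ; (there p) e → unvisited (lose p e) }) ch)
          (≰⇒> h≰j)
          (λ { (here refl) → j<g ; (there p) → j<us p })
          (λ { (here refl) _ → same ; (there p) → us-same p })

  improve : ∀ s {i j} → suc (suc (N s j)) ≤ N s i → Improved s
  improve s gap = grow (<-wellFounded _) [] (<⇒≤ gap) (λ ()) (λ ())
    where open Grow s gap

  Even : Set
  Even = ∃ λ s → ∀ l l′ → N s l ≤ suc (N s l′)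

  -- The inner recursion on `Q` runs while `low` stays within `m`; `lower` is the outer recursion on
  -- `low`.
  balance-squares : ∀ {m} → (∀ s → low s < m → Even) → ∀ s → low s ≤ m → Acc _<_ (Q s) → Even
  balance-squares lower s low≤ (acc rec)
    with any? (λ i → any? (λ j → suc (suc (N s j)) ≤? N s i))
  ... | no none = s , λ l l′ → s≤s⁻¹ (≰⇒> (λ le → none (l , l′ , le)))
  ... | yes (i , j , gap) with improve s gap
  ... | s′ , inj₁ lt = lower s′ (<-≤-trans lt low≤)
  ... | s′ , inj₂ (le , lt) = balance-squares lower s′ (≤-trans le low≤) (rec lt)

  balance : ∀ s → Acc _<_ (low s) → Even
  balance s (acc rec) =
    balance-squares (λ s′ lt → balance s′ (rec lt)) s ≤-refl (<-wellFounded (Q s))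

-- Balanced colourings from degrees not divisible by the number of colours.

module _ {n : ℕ} (G : Graph n) where

  degree : Fin n → ℕ
  degree w = ♯ (Counts.Adj? G {1} w)

  module _ {x : ℕ} where
    open Counts G {x}

    sum-cnt : ∀ c w → sum (λ l → cnt c l w) ≡ degree w
    sum-cnt c w = trans (∑-comm {x} {n} (λ l u → 𝟙 (Class? c l w u))) (sum-cong-≗ pointwise)
      where
      pointwise : ∀ u → sum (λ l → 𝟙 (Class? c l w u)) ≡ 𝟙 (Adj? w u)
      pointwise u with Adj? w u
      ... | no ¬a = ♯-empty (λ l → no ¬a ×-dec (c w u ≟ l)) (λ _ (a , _) → ¬a a)
      ... | yes a = trans (♯-cong (λ l → yes a ×-dec (c w u ≟ l)) (λ l → c w u ≟ l) proj₂ (a ,_))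
        (♯-singleton (c w u))

    -- Were all `x` frequencies at `w` equal, `x` would divide their sum, the degree.
    uneven : ∀ {w} → ¬ x ∣ degree w → ∀ c l → ∃ λ l′ → cnt c l′ w ≢ cnt c l w
    uneven {w} ¬div c l = ¬∀⟶∃¬ x (λ l′ → cnt c l′ w ≡ cnt c l w) (λ l′ → cnt c l′ w ℕ.≟ cnt c l w)
      (λ same → ¬div (divides (cnt c l w) (begin
        degree w                 ≡⟨ sym (sum-cnt c w) ⟩
        sum (λ l′ → cnt c l′ w)  ≡⟨ sum-cong-≗ same ⟩
        sum {x} (λ _ → cnt c l w) ≡⟨ sum-const x _ ⟩
        x * cnt c l w            ≡⟨ *-comm x _ ⟩
        cnt c l w * x            ∎)))
      where open ≡-Reasoning

  -- The vertices of the list join the balanced set one by one. The number of colours is a successor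
  -- so that a constant colouring is available to start from.
  balancedColouring : ∀ x (vs : List (Fin n)) → (∀ {w} → w ∈ vs → ¬ suc x ∣ degree w) →
                      Counts.State G {suc x} (_∈ vs)
  balancedColouring x [] _ = record
    { colour = λ _ _ → zero ; colour-sym = λ _ _ → refl ; balanced = λ () }
  balancedColouring x (v ∷ vs) ¬div with balancedColouring x vs (¬div ∘ there) | v ∈? vs
    where open import Data.List.Membership.DecPropositional _≟_ using (_∈?_)
  ... | s | yes v∈vs = record
    { colour = colour ; colour-sym = colour-sym
    ; balanced = λ { (here refl) → balanced v∈vs ; (there p) → balanced p } }
    where open Counts.State s
  ... | s | no v∉vs = record
    { colour = colour ; colour-sym = colour-sym
    ; balanced = λ { (here refl) → proj₂ result ; (there p) → balanced p } }
    where
    open import Data.List.Membership.DecPropositional _≟_ using (_∈?_)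
    open Improve G {suc x} (_∈ vs) (_∈? vs) v v∉vs
      (λ w∈vs s → uneven (¬div (there w∈vs)) (Counts.State.colour s))
    result = balance s (<-wellFounded _)
    open Counts.State (proj₁ result)

-- Pendant edges.

-- If x divides the degree of w, a pendant edge at w removes the obstruction; all pendant
-- edges may share their other end, which is never required to be balanced.
module Padded {n : ℕ} (G : Graph n) (x : ℕ) where

  flag : Fin n → Bool
  flag w = does (x ∣? degree G w)

  padded : Graph (suc n)
  padded = record { adj = a ; sym = a-sym ; irrefl = a-irrefl }
    where
    a : Fin (suc n) → Fin (suc n) → Bool
    a zero zero = false
    a zero (suc u) = flag u
    a (suc w) zero = flag w
    a (suc w) (suc u) = adj G w u
    a-sym : ∀ w u → a w u ≡ a u w
    a-sym zero zero = refl
    a-sym zero (suc u) = refl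
    a-sym (suc w) zero = refl
    a-sym (suc w) (suc u) = adj-sym G w u
    a-irrefl : ∀ w → a w w ≡ false
    a-irrefl zero = refl
    a-irrefl (suc w) = irrefl G w

  data Padding (w : Fin n) : Set where
    plain : ¬ x ∣ degree G w → flag w ≡ false → degree padded (suc w) ≡ degree G w → Padding w
    pendant : x ∣ degree G w → flag w ≡ true → degree padded (suc w) ≡ suc (degree G w) → Padding w

  padding : ∀ w → Padding w
  padding w = go (x ∣? degree G w) refl
    where
    go : (x∣? : Dec (x ∣ degree G w)) → flag w ≡ does x∣? → Padding w
    go (no ¬p) e = plain ¬p e (cong (_+ degree G w) (𝟙-no (flag w Bool.≟ true) λ p → contradiction (trans (sym p) e) λ ()))
    go (yes p) e = pendant p e (cong (_+ degree G w) (𝟙-yes (flag w Bool.≟ true) e))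

  -- A pendant edge turns a multiple of `x` into its successor, and an `x` dividing both would
  -- divide 1.
  indivisible : 2 ≤ x → ∀ w → ¬ x ∣ degree padded (suc w)
  indivisible 2≤x w div with padding w
  ... | plain ¬p _ e = ¬p (subst (x ∣_) e div)
  ... | pendant p _ e = <⇒≢ 2≤x (sym (∣1⇒≡1 (∣m+n∣m⇒∣n
    (subst (x ∣_) (trans e (+-comm 1 _)) div) p)))

-- From balanced colourings to degree bounds in every class.

EdgeColouring : ∀ {n} → Graph n → (r a x : ℕ) → Set
EdgeColouring {n} G r a x = Σ (Fin n → Fin n → Fin x) λ c → (∀ w u → c w u ≡ c u w) ×
  (∀ l w → r ≤ Counts.cnt G c l w × Counts.cnt G c l w ≤ r + a)

module _ {n : ℕ} (G : Graph n) (r a : ℕ) where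

  -- With all classes within one of each other, a class outside the range forces the degree sum past
  -- one of the bounds, whose strictness absorbs the pendant edge. A single colour is treated apart,
  -- because 1 divides every degree, padded or not.
  edgeColouring : ∀ x → (∀ w → r * suc x < degree G w × degree G w < (r + a) * suc x) →
                  EdgeColouring G r a (suc x)
  edgeColouring zero bounds = (λ _ _ → zero) , (λ _ _ → refl) , λ { zero w →
    subst (λ z → r ≤ z × z ≤ r + a) (sym (all-edges w))
      (subst (_≤ degree G w) (*-identityʳ r) (<⇒≤ (proj₁ (bounds w))) ,
       subst (degree G w ≤_) (*-identityʳ (r + a)) (<⇒≤ (proj₂ (bounds w)))) }
    where
    all-edges : ∀ w → Counts.cnt G {1} (λ _ _ → zero) zero w ≡ degree G w
    all-edges w = ♯-cong (Counts.Class? G (λ _ _ → zero) zero w) (Counts.Adj? G {1} w) proj₁ (_, refl)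
  edgeColouring (suc y) bounds =
    c , (λ w u → colour-sym (suc w) (suc u)) , λ l w → lower l w (padding w) , upper l w (padding w)
    where
    x = suc (suc y)
    open Padded G x
    indivisible′ : ∀ {w} → w ∈ map suc (allFin n) → ¬ x ∣ degree padded w
    indivisible′ p with ∈-map⁻ suc p
    ... | u , _ , refl = indivisible (s≤s (s≤s z≤n)) u
    open Counts.State (balancedColouring padded (suc y) (map suc (allFin n)) indivisible′)
    c : Fin n → Fin n → Fin x
    c w u = colour (suc w) (suc u)
    k : Fin x → Fin n → ℕ
    k l w = Counts.cnt G c l w
    k⁺ : Fin x → Fin n → ℕ
    k⁺ l w = Counts.cnt padded colour l (suc w)
    close : ∀ l l′ w → k⁺ l w ≤ suc (k⁺ l′ w)
    close l l′ w = balanced (∈-map⁺ suc (∈-allFin w)) l l′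
    k≤k⁺ : ∀ l w → k l w ≤ k⁺ l w
    k≤k⁺ l w = m≤n+m _ _
    k⁺≤ : ∀ l w → k⁺ l w ≤ suc (k l w)
    k⁺≤ l w = +-monoˡ-≤ (k l w)
      (≤-trans (𝟙-mono (Counts.Class? padded colour l (suc w) zero) (yes (refl {x = l})) (λ _ → refl)) ≤-refl)
    k⁺≡ : ∀ l w → flag w ≡ false → k⁺ l w ≡ k l w
    k⁺≡ l w e = cong (_+ k l w) (𝟙-no (Counts.Class? padded colour l (suc w) zero)
      (λ (p , _) → contradiction (trans (sym p) e) λ ()))
    at-most : ∀ {m} w → (∀ l → k⁺ l w ≤ m) → degree padded (suc w) ≤ m * x
    at-most {m} w le = begin
      degree padded (suc w)   ≡⟨ sym (sum-cnt padded colour (suc w)) ⟩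
      sum (λ l → k⁺ l w)      ≤⟨ sum-mono le ⟩
      sum {x} (λ _ → m)       ≡⟨ sum-const x m ⟩
      x * m                   ≡⟨ *-comm x m ⟩
      m * x                   ∎
      where open ≤-Reasoning
    more-than : ∀ {m} w l → (∀ l → m ≤ k⁺ l w) → m < k⁺ l w → m * x < degree padded (suc w)
    more-than {m} w l le lt = begin-strict
      m * x                   ≡⟨ *-comm m x ⟩
      x * m                   ≡⟨ sym (sum-const x m) ⟩
      sum {x} (λ _ → m)       <⟨ sum-mono-< le l lt ⟩
      sum (λ l → k⁺ l w)      ≡⟨ sum-cnt padded colour (suc w) ⟩
      degree padded (suc w)   ∎
      where open ≤-Reasoning
    lower : ∀ l w → Padding w → r ≤ k l w
    lower l w (plain _ unflagged deg≡) with r ≤? k l w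
    ... | yes le = le
    ... | no ¬le = contradiction
      (at-most w (λ l′ → ≤-trans (close l′ l w) (subst (λ z → suc z ≤ r) (sym (k⁺≡ l w unflagged)) (≰⇒> ¬le))))
      (<⇒≱ (subst (r * x <_) (sym deg≡) (proj₁ (bounds w))))
    -- Dropping the pendant edge may cost class `l` one edge. In return the degree, a multiple of
    -- `x` above `r * x`, is at least `suc r * x`, and the padded degree exceeds that.
    lower l w (pendant (divides q deg≡qx) _ deg≡) with r ≤? k l w
    ... | yes le = le
    ... | no ¬le = contradiction
      (at-most w (λ l′ → ≤-trans (close l′ l w) (s≤s (≤-trans (k⁺≤ l w) (≰⇒> ¬le)))))
      (<⇒≱ (begin-strict
        suc r * x              ≤⟨ *-monoˡ-≤ x (*-cancelʳ-< x r q (subst (r * x <_) deg≡qx (proj₁ (bounds w)))) ⟩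
        q * x                  ≡⟨ sym deg≡qx ⟩
        degree G w             <⟨ ≤-refl ⟩
        suc (degree G w)       ≡⟨ sym deg≡ ⟩
        degree padded (suc w)  ∎))
      where open ≤-Reasoning
    upper : ∀ l w → Padding w → k l w ≤ r + a
    upper l w p with k l w ≤? r + a
    ... | yes le = le
    ... | no ¬le = contradiction
      (more-than w l (λ l′ → s≤s⁻¹ (≤-trans large (close l l′ w))) large)
      (≤⇒≯ (≤-trans (deg⁺≤ p) (proj₂ (bounds w))))
      where
      large : r + a < k⁺ l w
      large = <-≤-trans (≰⇒> ¬le) (k≤k⁺ l w)
      deg⁺≤ : Padding w → degree padded (suc w) ≤ suc (degree G w)
      deg⁺≤ (plain _ _ e) = ≤-trans (≤-reflexive e) (n≤1+n _)
      deg⁺≤ (pendant _ _ e) = ≤-reflexive e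

-- Agreement with the degrees defined through lists.

length-filter : ∀ {n} {A : Set} (p : A → Bool) (f : Fin n → A) {P : Fin n → Set} (P? : Decidable P) →
                (∀ i → p (f i) ≡ does (P? i)) → length (filterᵇ p (tabulate f)) ≡ ♯ P?
length-filter {zero} p f P? same = refl
length-filter {suc n} p f P? same with p (f zero) | P? zero | same zero
... | true | yes _ | _ = cong suc (length-filter p (f ∘ suc) (P? ∘ suc) (same ∘ suc))
... | false | no _ | _ = length-filter p (f ∘ suc) (P? ∘ suc) (same ∘ suc)
... | true | no _ | ()
... | false | yes _ | ()

≟-true : ∀ b → b ≡ does (b Bool.≟ true)
≟-true true = refl
≟-true false = refl

deg≡degree : ∀ {n} (G : Graph n) w → deg G w ≡ degree G w
deg≡degree G w = length-filter (adj G w) id (Counts.Adj? G {1} w) (λ u → ≟-true (adj G w u))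

facDeg≡cnt : ∀ {n x} (G : Graph n) c (l : Fin x) w → facDeg G c l w ≡ Counts.cnt G c l w
facDeg≡cnt G c l w = length-filter _ id (Counts.Class? G c l w)
  (λ u → cong₂ _∧_ (≟-true (adj G w u)) (isYes≗does (c w u ≟ l)))

factorization : ∀ {n} (G : Graph n) {r a x} → 1 ≤ x →
                (∀ w → r * x < deg G w × deg G w < (r + a) * x) → Factorization G r a x
factorization G {r} {a} {suc x} _ bounds with edgeColouring G r a x
  (λ w → subst (λ z → r * suc x < z × z < (r + a) * suc x) (deg≡degree G w) (bounds w))
... | c , c-sym , ok = record
  { colour = c
  ; colourSym = c-sym
  ; factorDeg = λ l w → subst (λ z → r ≤ z × z ≤ r + a) (sym (facDeg≡cnt G c l w)) (ok l w)
  }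

-- The arithmetic of the bound.

ceilDiv-upper : ∀ m a → 1 ≤ a → m ≤ ceilDiv m a * a
ceilDiv-upper m (suc b) _ = +-cancelʳ-≤ b _ _ (begin
  m + b                              ≡⟨ m≡m%n+[m/n]*n (m + b) (suc b) ⟩
  -- The remainder is at most `b`, the amount added before dividing.
  (m + b) % suc b + ceilDiv m (suc b) * suc b ≤⟨ +-monoˡ-≤ _ (s≤s⁻¹ (m%n<n (m + b) (suc b))) ⟩
  b + ceilDiv m (suc b) * suc b      ≡⟨ +-comm b _ ⟩
  ceilDiv m (suc b) * suc b + b      ∎)
  where open ≤-Reasoning

theorem22 : (r s a t : ℕ) → 1 ≤ r → 2 ≤ a → 1 ≤ t →
    ∀ (d : ℕ) → r * ceilDiv (t * r + s + 1) a + (t ∸ 1) * r + 1 ≤ d →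
    ∀ (n : ℕ) (G : Graph n) → IsDDSGraph d s G →
    HasFactorizationsForTValues G r a t
theorem22 r@(suc _) s a t@(suc t′) _ 2≤a _ zero large =
  contradiction (≤-trans (m≤n+m 1 (r * ceilDiv (t * r + s + 1) a + t′ * r)) large) λ ()
-- From here on `d` is one less than the lower bound on the degrees, so that `d / r` is the largest
-- `X` with `r * X` strictly below that bound.
theorem22 r@(suc _) s a t@(suc t′) _ 2≤a _ (suc d) large n G degrees =
  factors , injective , λ i → factorization G {r} {a} (positive i) (λ w → below i w , above i w)
  where
  open ≤-Reasoning
  c = ceilDiv (t * r + s + 1) a
  X = d / r
  c-large : t * r + s + 1 ≤ c * a
  c-large = ceilDiv-upper (t * r + s + 1) a (<⇒≤ 2≤a)
  c≥1 : 1 ≤ c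
  c≥1 with c | c-large
  ... | zero | le = contradiction (≤-trans (m≤n+m 1 (t * r + s)) le) λ ()
  ... | suc _ | _ = s≤s z≤n
  -- This leaves room for `t` values: even the smallest one, `X ∸ t′`, is at least `c`.
  X-large : c + t′ ≤ X
  X-large = begin
    c + t′            ≡⟨ sym (m*n/n≡m (c + t′) r) ⟩
    (c + t′) * r / r  ≤⟨ /-monoˡ-≤ r (s≤s⁻¹ (begin
      suc ((c + t′) * r)      ≡⟨ cong suc (*-distribʳ-+ r c t′) ⟩
      suc (c * r + t′ * r)    ≡⟨ cong (λ z → suc (z + t′ * r)) (*-comm c r) ⟩
      suc (r * c + t′ * r)    ≡⟨ +-comm 1 _ ⟩
      r * c + t′ * r + 1      ≤⟨ large ⟩
      suc d                   ∎)) ⟩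
    d / r             ∎
  d<Xr+r : suc d ≤ r + X * r
  d<Xr+r = begin
    suc d                  ≡⟨ cong suc (m≡m%n+[m/n]*n d r) ⟩
    suc (d % r) + X * r    ≤⟨ +-monoˡ-≤ (X * r) (m%n<n d r) ⟩
    r + X * r              ∎
  factors : Fin t → ℕ
  factors i = X ∸ toℕ i
  i≤t′ : ∀ (i : Fin t) → toℕ i ≤ t′
  i≤t′ i = s≤s⁻¹ (toℕ<n i)
  c≤ : ∀ i → c ≤ factors i
  c≤ i = begin
    c             ≡⟨ sym (m+n∸n≡m c t′) ⟩
    c + t′ ∸ t′   ≤⟨ ∸-monoˡ-≤ t′ X-large ⟩
    X ∸ t′        ≤⟨ ∸-monoʳ-≤ X (i≤t′ i) ⟩
    X ∸ toℕ i     ∎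
  i≤X : ∀ i → toℕ i ≤ X
  i≤X i = ≤-trans (i≤t′ i) (≤-trans (m≤n+m t′ c) X-large)
  injective : ∀ {i j} → factors i ≡ factors j → i ≡ j
  injective {i} {j} e = toℕ-injective (∸-cancelˡ-≡ (i≤X i) (i≤X j) e)
  positive : ∀ i → 1 ≤ factors i
  positive i = ≤-trans c≥1 (c≤ i)
  below : ∀ i w → r * factors i < deg G w
  below i w = begin-strict
    r * (X ∸ toℕ i)  ≤⟨ *-monoʳ-≤ r (m∸n≤m X (toℕ i)) ⟩
    r * X            ≡⟨ *-comm r X ⟩
    X * r            ≤⟨ m/n*n≤m d r ⟩
    d                <⟨ proj₁ (degrees w) ⟩
    deg G w          ∎
  above : ∀ i w → deg G w < (r + a) * factors i
  above i w = begin-strict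
    deg G w                       ≤⟨ proj₂ (degrees w) ⟩
    suc d + s                     ≤⟨ +-monoˡ-≤ s d<Xr+r ⟩
    r + X * r + s                 ≡⟨ cong (λ z → r + z * r + s) (sym (m∸n+n≡m (i≤X i))) ⟩
    r + (y + toℕ i) * r + s       ≤⟨ +-monoˡ-≤ s (+-monoʳ-≤ r (*-monoˡ-≤ r (+-monoʳ-≤ y (i≤t′ i)))) ⟩
    -- Since `r + t′ * r` is `t * r`, the part beyond `r * y` is one short of the numerator
    -- `t * r + s + 1` of the ceiling; that 1 makes the bound strict.
    r + (y + t′) * r + s          <⟨ ≤-reflexive (solve 4 (λ r y t s →
        con 1 :+ (r :+ (y :+ t) :* r :+ s) := r :* y :+ (r :+ t :* r :+ s :+ con 1)) refl r y t′ s) ⟩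
    r * y + (t * r + s + 1)       ≤⟨ +-monoʳ-≤ (r * y) (≤-trans c-large (*-monoˡ-≤ a (c≤ i))) ⟩
    r * y + y * a                 ≡⟨ solve 3 (λ r y a → r :* y :+ y :* a := (r :+ a) :* y) refl r y a ⟩
    (r + a) * y                   ∎
    where
    y = factors i
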